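{- Let $n \geqslant 2$ and let $G_1, \ldots, G_n$ be finite graphs, where $G_i$ has $v_i \geqslant 1$ vertices. Put $v = \sum_{i=1}^{n} v_i$ and let $G = G_1\nabla G_2\nabla\cdots\nabla G_n$ be their product. Let $\tau(G)$ be the number of spanning trees of $G$ and let $d_G(u)$ denote the degree of a vertex $u$ in $G$. Then $$\tau(G) \leqslant v^{n-2}\,\frac{\prod_{u\in V(G)} d_G(u)}{\prod_{i=1}^{n}(v-v_i)}.$$
   Context: Graphs are undirected, without loops and without multiple edges; the $G_i$ need not be connected. The product $G = G_1\nabla G_2\nabla\cdots\nabla G_n$ is the graph whose vertex set is the disjoint union $V(G)=\bigsqcup_{i=1}^n V(G_i)$ and whose edges are all edges of all the $G_i$ together with all pairs $xy$ with $x\in V(G_i)$, $y\in V(G_j)$, $1\leqslant i<j\leqslant n$ (so every two vertices from different $G_i$'s are adjacent). -}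

module Defs where

open import Data.Fin.Base using (Fin; zero; suc)
open import Data.Fin.Properties using (injective⇒≤) renaming (_≟_ to _≟ᶠ_)
open import Data.List.Base using (List; []; _∷_; _++_; map; concat; concatMap; filter; length; lookup; tabulate)
open import Data.List.Membership.Propositional using (_∈_; find; lose)
open import Data.List.Membership.Propositional.Properties using (∈-map⁺; ∈-map⁻; ∈-concat⁺′; ∈-concatMap⁺; ∈-tabulate⁺; ∈-lookup)
import Data.List.Membership.DecPropositional as DecMembership
open import Data.List.Membership.Setoid.Properties using (index-injective)
open import Data.List.Relation.Unary.All as All using (All; []; _∷_)
import Data.List.Relation.Unary.All.Properties as All
open import Data.List.Relation.Unary.Any as Any using (here; there; any?)
import Data.List.Relation.Unary.AllPairs.Properties as AllPairs
open import Data.List.Relation.Unary.AllPairs using ([]; _∷_)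
open import Data.List.Relation.Unary.Unique.Propositional using (Unique)
import Data.List.Relation.Unary.Unique.DecPropositional as DecUnique
import Data.List.Relation.Unary.Unique.Propositional.Properties as Unique
open import Data.Nat.Base using (ℕ; zero; suc; _∸_; _≤_; _<_; s≤s; NonZero; >-nonZero)
open import Data.Nat.ListAction using (sum; product)
open import Data.Nat.ListAction.Properties using (product≢0)
open import Data.Nat.Properties using (_≤?_; ≤-trans; n≤1+n; m≤m+n; m≤n+m; m<m+n; m<n+m; m<n⇒0<n∸m)
open import Data.Product.Base using (Σ; ∃; ∃-syntax; _×_; _,_; proj₁)
open import Data.Product.Properties using (≡-dec)
open import Data.Sum.Base using (_⊎_; swap)
open import Function.Base using (_∘_)
open import Relation.Binary.Definitions using (DecidableEquality)
open import Relation.Binary.PropositionalEquality using (_≡_; _≢_; refl; sym; trans; cong; setoid)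
open import Relation.Nullary using (¬_; Dec; yes; no; ¬?; contradiction)
open import Relation.Nullary.Decidable using (map′; _×-dec_; _⊎-dec_)
open import Relation.Unary using (Decidable)

∑ : ∀ {n} → (Fin n → ℕ) → ℕ
∑ f = sum (tabulate f)

∏ : ∀ {n} → (Fin n → ℕ) → ℕ
∏ f = product (tabulate f)

-- Finiteness of the vertex set is witnessed by a repetition-free list of all
-- vertices.
record FinGraph : Set₁ where
  infix 4 _~_ _~?_ _≟_
  field
    V        : Set
    _≟_      : DecidableEquality V
    vertices : List V
    unique   : Unique vertices
    complete : ∀ u → u ∈ vertices
    _~_      : V → V → Set
    _~?_     : ∀ u w → Dec (u ~ w)
    ~-sym    : ∀ {u w} → u ~ w → w ~ u
    ~-irrefl : ∀ {u} → ¬ (u ~ u)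

  order : ℕ
  order = length vertices

  degree : V → ℕ
  degree u = length (filter (u ~?_) vertices)

  -- Walk u xs w: the vertex sequence u ∷ xs is a walk from u to w.
  data Walk : V → List V → V → Set where
    []  : ∀ {u} → Walk u [] u
    _∷_ : ∀ {u x xs w} → u ~ x → Walk x xs w → Walk u (x ∷ xs) w

  Connected : Set
  Connected = ∀ u w → ∃[ xs ] Walk u xs w

  -- Cycle u xs w: the vertices u ∷ xs, ending in w, are at least three,
  -- distinct, and cyclically adjacent.
  Cycle : V → List V → V → Set
  Cycle u xs w = Walk u xs w × Unique (u ∷ xs) × 2 ≤ length xs × w ~ u

  Acyclic : Set
  Acyclic = ¬ (∃[ u ] ∃[ w ] ∃[ xs ] Cycle u xs w)

  IsTree : Set
  IsTree = Connected × Acyclic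

  open DecMembership _≟_ using (_∈?_)
  open DecUnique _≟_ using (unique?)

  walk? : ∀ u xs w → Dec (Walk u xs w)
  walk? u [] w = map′ (λ { refl → [] }) (λ { [] → refl }) (u ≟ w)
  walk? u (x ∷ xs) w =
    map′ (λ { (e , p) → e ∷ p }) (λ { (e ∷ p) → e , p }) ((u ~? x) ×-dec walk? x xs w)

  lookup-injective : ∀ {xs : List V} → Unique xs →
                     ∀ {i j} → lookup xs i ≡ lookup xs j → i ≡ j
  lookup-injective (_ ∷ _) {zero} {zero} _ = refl
  lookup-injective {x ∷ xs} (x∉ ∷ _) {zero} {suc j} eq =
    contradiction eq (All.lookup x∉ (∈-lookup j))
  lookup-injective {x ∷ xs} (x∉ ∷ _) {suc i} {zero} eq =
    contradiction (sym eq) (All.lookup x∉ (∈-lookup i))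
  lookup-injective (_ ∷ u) {suc i} {suc j} eq = cong suc (lookup-injective u eq)

  unique⇒length≤order : ∀ {xs} → Unique xs → length xs ≤ order
  unique⇒length≤order {xs} u =
    injective⇒≤ {f = λ i → Any.index (complete (lookup xs i))}
      (λ eq → lookup-injective u (index-injective (setoid V) (complete _) (complete _) eq))

  sequences : ℕ → List (List V)
  sequences zero    = [] ∷ []
  sequences (suc k) = [] ∷ concatMap (λ x → map (x ∷_) (sequences k)) vertices

  ∈-sequences : ∀ k xs → length xs ≤ k → xs ∈ sequences k
  ∈-sequences zero    []       _         = here refl
  ∈-sequences (suc k) []       _         = here refl
  ∈-sequences (suc k) (x ∷ xs) (s≤s le) =
    there (∈-concatMap⁺ (λ y → map (y ∷_) (sequences k))
             (Any.map (λ { refl → ∈-map⁺ (x ∷_) (∈-sequences k xs le) }) (complete x)))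

  ∃sequence? : {P : List V → Set} → Decidable P → (∀ {xs} → P xs → length xs ≤ order) →
               Dec (∃ P)
  ∃sequence? P? bound =
    map′ (λ a → let (xs , _ , p) = find a in xs , p)
         (λ { (xs , p) → lose (∈-sequences order xs (bound p)) p })
         (any? P? (sequences order))

  ∃vertex? : {P : V → Set} → Decidable P → Dec (∃ P)
  ∃vertex? P? =
    map′ (λ a → let (u , _ , p) = find a in u , p)
         (λ { (u , p) → lose (complete u) p })
         (any? P? vertices)

  ∀vertex? : {P : V → Set} → Decidable P → Dec (∀ u → P u)
  ∀vertex? P? = map′ (λ a u → All.lookup a (complete u)) (λ f → All.universal f _)
                     (All.all? P? vertices)

  Path : V → List V → V → Set
  Path u xs w = Walk u xs w × Unique (u ∷ xs)

  suffix : ∀ {u x xs w} → u ∈ x ∷ xs → Path x xs w → ∃[ ys ] Path u ys w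
  suffix (here refl) p                   = _ , p
  suffix (there u∈) (_ ∷ p , _ ∷ distinct) = suffix u∈ (p , distinct)

  walk⇒path : ∀ {u xs w} → Walk u xs w → ∃[ ys ] Path u ys w
  walk⇒path [] = [] , [] , [] ∷ []
  walk⇒path {u} (_∷_ {x = x} e p) with walk⇒path p
  ... | ys , q , distinct with u ∈? (x ∷ ys)
  ... | yes u∈ = suffix u∈ (q , distinct)
  ... | no  u∉ = x ∷ ys , e ∷ q , All.¬Any⇒All¬ _ u∉ ∷ distinct

  connected? : Dec Connected
  connected? = ∀vertex? λ u → ∀vertex? λ w →
    map′ (λ { (xs , p , _) → xs , p }) (λ { (_ , p) → walk⇒path p })
      (∃sequence? (λ xs → walk? u xs w ×-dec unique? (u ∷ xs))
         (λ { (_ , distinct) → ≤-trans (n≤1+n _) (unique⇒length≤order distinct) }))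

  cycle? : Dec (∃[ u ] ∃[ w ] ∃[ xs ] Cycle u xs w)
  cycle? = ∃vertex? λ u → ∃vertex? λ w →
    ∃sequence? (λ xs → walk? u xs w ×-dec unique? (u ∷ xs) ×-dec (2 ≤? length xs) ×-dec (w ~? u))
      (λ { (_ , distinct , _) → ≤-trans (n≤1+n _) (unique⇒length≤order distinct) })

  isTree? : Dec IsTree
  isTree? = connected? ×-dec ¬? cycle?

open FinGraph using (V; order; degree; vertices; IsTree; isTree?)

pairs : ∀ {A : Set} → List A → List (A × A)
pairs []       = []
pairs (x ∷ xs) = map (x ,_) xs ++ pairs xs

sublists : ∀ {A : Set} → List A → List (List A)
sublists []       = [] ∷ []
sublists (x ∷ xs) = sublists xs ++ map (x ∷_) (sublists xs)

-- Each edge occurs once, oriented by the order of its ends in the vertex list.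
edges : (G : FinGraph) → List (V G × V G)
edges G = filter (λ (u , w) → u ~? w) (pairs (vertices G))
  where open FinGraph G using (_~?_)

-- The spanning subgraph of G with those edges of G that are listed in T, in
-- either orientation.
_↾_ : (G : FinGraph) → List (V G × V G) → FinGraph
G ↾ T = record
  { V        = G.V
  ; _≟_      = G._≟_
  ; vertices = G.vertices
  ; unique   = G.unique
  ; complete = G.complete
  ; _~_      = λ u w → u G.~ w × ((u , w) ∈ T ⊎ (w , u) ∈ T)
  ; _~?_     = λ u w → (u G.~? w) ×-dec (((u , w) ∈? T) ⊎-dec ((w , u) ∈? T))
  ; ~-sym    = λ { (e , t) → G.~-sym e , swap t }
  ; ~-irrefl = λ { (e , _) → G.~-irrefl e }
  }
  where
  module G = FinGraph G
  open DecMembership (≡-dec G._≟_ G._≟_) using (_∈?_)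

-- Number of edge sets T ⊆ E(G) for which (V(G), T) is a tree.
τ : FinGraph → ℕ
τ G = length (filter (λ T → isTree? (G ↾ T)) (sublists (edges G)))

∏-degrees : FinGraph → ℕ
∏-degrees G = product (map (degree G) (vertices G))

module _ {n : ℕ} (G : Fin n → FinGraph) where
  private module G i = FinGraph (G i)

  data Adj∇ : Σ (Fin n) G.V → Σ (Fin n) G.V → Set where
    within : ∀ {i x y} → G._~_ i x y → Adj∇ (i , x) (i , y)
    across : ∀ {i j x y} → i ≢ j → Adj∇ (i , x) (j , y)

  blocks : Fin n → List (Σ (Fin n) G.V)
  blocks i = map (i ,_) (G.vertices i)

  adj∇? : ∀ u w → Dec (Adj∇ u w)
  adj∇? (i , x) (j , y) with i ≟ᶠ j
  ... | no  i≢j  = yes (across i≢j)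
  ... | yes refl = map′ within
        (λ { (within e) → e ; (across i≢i) → contradiction refl i≢i })
        (G._~?_ i x y)

  sym∇ : ∀ {u w} → Adj∇ u w → Adj∇ w u
  sym∇ (within e)   = within (G.~-sym _ e)
  sym∇ (across i≢j) = across (i≢j ∘ sym)

  irrefl∇ : ∀ {u} → ¬ Adj∇ u u
  irrefl∇ (within e)   = G.~-irrefl _ e
  irrefl∇ (across i≢i) = i≢i refl

  unique∇ : Unique (concat (tabulate blocks))
  unique∇ = Unique.concat⁺
    (All.tabulate⁺ λ i → Unique.map⁺ (λ { refl → refl }) (G.unique i))
    (AllPairs.tabulate⁺ λ i≢j (p , q) →
      let (_ , _ , eq₁) = ∈-map⁻ _ p
          (_ , _ , eq₂) = ∈-map⁻ _ q
      in i≢j (cong proj₁ (trans (sym eq₁) eq₂)))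

  complete∇ : ∀ u → u ∈ concat (tabulate blocks)
  complete∇ (i , x) = ∈-concat⁺′ (∈-map⁺ (i ,_) (G.complete i x)) (∈-tabulate⁺ i)

  ∇ : FinGraph
  ∇ = record
    { V        = Σ (Fin n) G.V
    ; _≟_      = ≡-dec _≟ᶠ_ (λ {i} → G._≟_ i)
    ; vertices = concat (tabulate blocks)
    ; unique   = unique∇
    ; complete = complete∇
    ; _~_      = Adj∇
    ; _~?_     = adj∇?
    ; ~-sym    = sym∇
    ; ~-irrefl = irrefl∇
    }

term≤∑ : ∀ {n} (f : Fin n → ℕ) i → f i ≤ ∑ f
term≤∑ f zero    = m≤m+n _ _
term≤∑ f (suc i) = ≤-trans (term≤∑ (f ∘ suc) i) (m≤n+m _ _)

term<∑ : ∀ {n} → 2 ≤ n → (f : Fin n → ℕ) → (∀ i → 1 ≤ f i) → ∀ i → f i < ∑ f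
term<∑ (s≤s (s≤s _)) f pos zero =
  m<m+n (f zero) (≤-trans (pos (suc zero)) (term≤∑ (f ∘ suc) zero))
term<∑ (s≤s (s≤s _)) f pos (suc i) =
  ≤-trans (s≤s (term≤∑ (f ∘ suc) i)) (m<n+m _ (pos zero))

∏[v∸vᵢ]≢0 : ∀ {n} → 2 ≤ n → (f : Fin n → ℕ) → (∀ i → 1 ≤ f i) →
            NonZero (∏ (λ i → ∑ f ∸ f i))
∏[v∸vᵢ]≢0 2≤n f pos =
  product≢0 (All.tabulate⁺ λ i → >-nonZero (m<n⇒0<n∸m (term<∑ 2≤n f pos i)))

{-# OPTIONS --safe #-}
-- Clearing denominators, the claim is τ(G) ∏ᵢ (v − vᵢ) ≤ v^(n−2) ∏ᵤ d(u). A Prüfer-like code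
-- maps pairs (T, e), with T a spanning tree and e ∈ ∏ᵢ (V ∖ Vᵢ), injectively to pairs (f, c) with
-- f(u) a neighbour of u for each vertex u, and c a word of n − 2 vertices.
--
-- Delete leaves one at a time until two vertices remain, preferring leaves that are not the
-- last remaining vertex of their block Vᵢ. Let p be the neighbour of the deleted leaf u ∈ Vᵢ.
-- If p ∈ Vᵢ, put f(u) = p. Otherwise append p to a queue of the block Vᵢ or, when u is the last
-- vertex of Vᵢ, to the common word c. The preference ensures that the two vertices left at the
-- end lie in different blocks, so c has length n − 2, while the queue of Vᵢ is one shorter than
-- the set of vertices of Vᵢ on which f is still undefined: eᵢ followed by the queue fills
-- exactly these slots. As for Prüfer codes, the leaves of the current tree are the remaining
-- vertices that do not occur in the remaining code, so T can be reconstructed.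
module Submission where

open import Defs
open import Data.Fin.Base using (Fin; zero; suc)
open import Data.Fin.Properties using () renaming (_≟_ to _≟ᶠ_)
import Data.Integer.Base as ℤ
import Data.Integer.Properties as ℤ
open import Data.List.Base using (List; []; _∷_; _++_; map; filter; length; tabulate; allFin; concat; cartesianProduct; cartesianProductWith)
open import Data.List.Properties using (length-++; length-map; length-tabulate; map-cong; map-cong-local; map-∘; map-tabulate; filter-all; filter-none; filter-notAll; filter-accept; filter-reject; filter-≐; filter-++; ∷-injective; ∷-injectiveˡ; ∷-injectiveʳ)
open import Data.List.Membership.Propositional using (_∈_; _∉_; find; lose)
open import Data.List.Membership.Propositional.Properties using (∈-++⁺ˡ; ∈-++⁺ʳ; ∈-++⁻; ∈-∃++; ∈-map⁺; ∈-map⁻; ∈-filter⁺; ∈-filter⁻; ∈-cartesianProduct⁺; ∈-cartesianProduct⁻; ∈-cartesianProductWith⁺; ∈-cartesianProductWith⁻; ∈-allFin)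
import Data.List.Membership.DecPropositional as DecMembership
open import Data.List.Relation.Unary.All as All using (All; []; _∷_)
import Data.List.Relation.Unary.All.Properties as All
open import Data.List.Relation.Unary.AllPairs using ([]; _∷_)
open import Data.List.Relation.Unary.Any as Any using (Any; here; there; any?)
open import Data.List.Relation.Unary.Unique.Propositional using (Unique)
import Data.List.Relation.Unary.Unique.Propositional.Properties as Unique
open import Data.Maybe.Base using (Maybe; just; nothing; fromMaybe)
open import Data.Maybe.Properties using (just-injective) renaming (≡-dec to Maybe-≡-dec)
open import Data.Nat.Base using (ℕ; zero; suc; _+_; _∸_; _^_; _<_; z≤n; s≤s; s≤s⁻¹; NonZero) renaming (_≤_ to _≤ⁿ_; _*_ to _*ⁿ_)
open import Data.Nat.ListAction using (product)
open import Data.Nat.Properties using (+-suc; +-comm; +-assoc; +-identityʳ; *-comm; m+n∸n≡m; m≤n+m; suc-injective; ≤-refl; ≤-trans; ≤-reflexive; module ≤-Reasoning) renaming (_≟_ to _≟ℕ_)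
open import Data.Product.Base using (Σ; ∃; ∃-syntax; ∃₂; _×_; _,_; proj₁; proj₂)
open import Data.Product.Properties using (≡-dec)
open import Data.Rational.Base using (_≤_; _*_; _/_; toℚᵘ)
open import Data.Rational.Properties using (toℚᵘ-cancel-≤; toℚᵘ-fromℚᵘ; toℚᵘ-homo-*)
import Data.Rational.Unnormalised.Base as ℚᵘ
import Data.Rational.Unnormalised.Properties as ℚᵘ
open import Data.Sum.Base using (_⊎_; inj₁; inj₂; [_,_]′) renaming (map to ⊎-map)
open import Function.Base using (_∘_; id; case_of_)
open import Relation.Binary.Construct.Closure.ReflexiveTransitive as Star using (Star; ε; _◅_; _◅◅_)
open import Relation.Binary.Definitions using (DecidableEquality)
open import Relation.Binary.PropositionalEquality using (_≡_; _≢_; refl; sym; trans; cong; cong₂; subst; module ≡-Reasoning)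
open import Relation.Nullary using (¬_; Dec; yes; no; ¬?; contradiction)
open import Relation.Nullary.Decidable using (_×-dec_; _⊎-dec_)
open import Relation.Unary using (Decidable)

-- Finite counting: injections, products of lists, words and filtered lists.

private variable
  A B : Set

-- Pigeonhole principle, by induction on `xs`: the occurrence of the partner `y` of the head is cut
-- out of `ys`, and no later element can use it, because `y` determines the element related to it.
-- With a relation, decoding only has to be single-valued.
functional⇒length≤ : {R : B → A → Set} → (∀ {y x x′} → R y x → R y x′ → x ≡ x′) →
  ∀ {xs} ys → Unique xs → (∀ {x} → x ∈ xs → ∃[ y ] y ∈ ys × R y x) → length xs ≤ⁿ length ys
functional⇒length≤ func {[]} ys _ _ = z≤n
functional⇒length≤ {R = R} func {x ∷ xs} ys (x∉ ∷ uniq) f with f (here refl)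
... | y , y∈ , Ryx with ∈-∃++ y∈
... | as , bs , refl =
  ≤-trans (s≤s (functional⇒length≤ func (as ++ bs) uniq step)) (≤-reflexive eq)
  where
  step : ∀ {z} → z ∈ xs → ∃[ w ] w ∈ as ++ bs × R w z
  step z∈ with f (there z∈)
  ... | w , w∈ , Rwz with ∈-++⁻ as w∈
  ... | inj₁ w∈as = w , ∈-++⁺ˡ w∈as , Rwz
  ... | inj₂ (here refl) = contradiction (func Ryx Rwz) (All.lookup x∉ z∈)
  ... | inj₂ (there w∈bs) = w , ∈-++⁺ʳ as w∈bs , Rwz
  eq : suc (length (as ++ bs)) ≡ length (as ++ y ∷ bs)
  eq = trans (cong suc (length-++ as)) (trans (sym (+-suc _ _)) (sym (length-++ as)))

unique-∉ : ∀ {x : A} {xs} → Unique (x ∷ xs) → x ∉ xs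
unique-∉ (x≢ ∷ _) x∈ = All.lookup x≢ x∈ refl

length-cartesianProductWith : ∀ {C : Set} (f : A → B → C) xs ys →
  length (cartesianProductWith f xs ys) ≡ length xs *ⁿ length ys
length-cartesianProductWith f [] ys = refl
length-cartesianProductWith f (x ∷ xs) ys =
  trans (length-++ (map (f x) ys))
    (cong₂ _+_ (length-map (f x) ys) (length-cartesianProductWith f xs ys))

-- The Cartesian product of a list of lists. Functions on a finite set are counted through their
-- lists of values, so that equality of codes is equality of lists.
choices : List (List A) → List (List A)
choices []         = [] ∷ []
choices (xs ∷ xss) = cartesianProductWith _∷_ xs (choices xss)

length-choices : (xss : List (List A)) → length (choices xss) ≡ product (map length xss)
length-choices []         = refl
length-choices (xs ∷ xss) =
  trans (length-cartesianProductWith _∷_ xs (choices xss)) (cong (length xs *ⁿ_) (length-choices xss))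

choices-unique : {xss : List (List A)} → All Unique xss → Unique (choices xss)
choices-unique []       = [] ∷ []
choices-unique (u ∷ us) = Unique.cartesianProductWith⁺ _∷_ ∷-injective u (choices-unique us)

∈-choices⁺ : (F : B → List A) (f : B → A) → (∀ x → f x ∈ F x) →
  ∀ xs → map f xs ∈ choices (map F xs)
∈-choices⁺ F f f∈ []       = here refl
∈-choices⁺ F f f∈ (x ∷ xs) = ∈-cartesianProductWith⁺ _∷_ (f∈ x) (∈-choices⁺ F f f∈ xs)

map-≡⇒≗ : {f g : A → B} → ∀ xs → map f xs ≡ map g xs → ∀ {x} → x ∈ xs → f x ≡ g x
map-≡⇒≗ (x ∷ xs) eq (here refl) = proj₁ (∷-injective eq)
map-≡⇒≗ (x ∷ xs) eq (there x∈)  = map-≡⇒≗ xs (proj₂ (∷-injective eq)) x∈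

words : ℕ → List A → List (List A)
words zero    xs = [] ∷ []
words (suc k) xs = cartesianProductWith _∷_ xs (words k xs)

length-words : ∀ k (xs : List A) → length (words k xs) ≡ length xs ^ k
length-words zero    xs = refl
length-words (suc k) xs =
  trans (length-cartesianProductWith _∷_ xs (words k xs)) (cong (length xs *ⁿ_) (length-words k xs))

∈-words : ∀ {xs : List A} → (∀ x → x ∈ xs) → ∀ ys → ys ∈ words (length ys) xs
∈-words all∈ []       = here refl
∈-words all∈ (y ∷ ys) = ∈-cartesianProductWith⁺ _∷_ (all∈ y) (∈-words all∈ ys)

indicator : ∀ {P : Set} → Dec P → ℕ
indicator (yes _) = 1
indicator (no _)  = 0

indicator-cong : ∀ {P Q : Set} (p : Dec P) (q : Dec Q) → (P → Q) → (Q → P) → indicator p ≡ indicator q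
indicator-cong (yes _) (yes _) _ _ = refl
indicator-cong (yes p) (no ¬q) f _ = contradiction (f p) ¬q
indicator-cong (no ¬p) (yes q) _ g = contradiction (g q) ¬p
indicator-cong (no _)  (no _)  _ _ = refl

indicator-yes : ∀ {P : Set} (p : Dec P) → P → indicator p ≡ 1
indicator-yes (yes _) _ = refl
indicator-yes (no ¬p) p = contradiction p ¬p

indicator-no : ∀ {P : Set} (p : Dec P) → ¬ P → indicator p ≡ 0
indicator-no (no _)  _  = refl
indicator-no (yes p) ¬p = contradiction p ¬p

count : {P : A → Set} → Decidable P → List A → ℕ
count P? xs = length (filter P? xs)

count-∷ : {P : A → Set} (P? : Decidable P) → ∀ x xs → count P? (x ∷ xs) ≡ indicator (P? x) + count P? xs
count-∷ P? x xs with P? x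
... | yes _ = refl
... | no  _ = refl

count-cong : {P Q : A → Set} (P? : Decidable P) (Q? : Decidable Q) → ∀ xs →
  (∀ {x} → x ∈ xs → P x → Q x) → (∀ {x} → x ∈ xs → Q x → P x) → count P? xs ≡ count Q? xs
count-cong P? Q? []       f g = refl
count-cong P? Q? (x ∷ xs) f g =
  trans (count-∷ P? x xs)
    (trans (cong₂ _+_ (indicator-cong (P? x) (Q? x) (f (here refl)) (g (here refl)))
                      (count-cong P? Q? xs (f ∘ there) (g ∘ there)))
           (sym (count-∷ Q? x xs)))

count-none : {P : A → Set} (P? : Decidable P) → ∀ {xs} → (∀ {x} → x ∈ xs → ¬ P x) → count P? xs ≡ 0
count-none P? none = cong length (filter-none P? (All.tabulate none))

-- Removal of an element from a list; pointwise update of functions.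

module Removal {A : Set} (_≟_ : DecidableEquality A) where

  infixl 6 _∖_

  abstract
    _∖_ : List A → A → List A
    xs ∖ x = filter (λ y → ¬? (y ≟ x)) xs

    ∈-∖⁺ : ∀ {x y xs} → y ∈ xs → y ≢ x → y ∈ xs ∖ x
    ∈-∖⁺ {x} = ∈-filter⁺ (λ y → ¬? (y ≟ x))

    ∈-∖⁻ : ∀ {x y xs} → y ∈ xs ∖ x → y ∈ xs × y ≢ x
    ∈-∖⁻ {x} = ∈-filter⁻ (λ y → ¬? (y ≟ x))

    ∖-unique : ∀ {x xs} → Unique xs → Unique (xs ∖ x)
    ∖-unique {x} = Unique.filter⁺ (λ y → ¬? (y ≟ x))

    count-∖ : {P : A → Set} (P? : Decidable P) → ∀ {x xs} → Unique xs → x ∈ xs →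
      count P? xs ≡ indicator (P? x) + count P? (xs ∖ x)
    count-∖ P? {x} {.x ∷ xs} (x≢ ∷ u) (here refl) =
      trans (count-∷ P? x xs) (cong (λ zs → indicator (P? x) + count P? zs)
        (sym (trans (filter-reject (λ y → ¬? (y ≟ x)) (λ f → f refl))
          (filter-all (λ y → ¬? (y ≟ x)) (All.map (λ ne eq → ne (sym eq)) x≢)))))
    count-∖ P? {x} {y ∷ xs} (y≢ ∷ u) (there x∈) = begin
      count P? (y ∷ xs)                                          ≡⟨ count-∷ P? y xs ⟩
      indicator (P? y) + count P? xs                             ≡⟨ cong (indicator (P? y) +_) (count-∖ P? u x∈) ⟩
      indicator (P? y) + (indicator (P? x) + count P? (xs ∖ x))  ≡⟨ sym (+-assoc (indicator (P? y)) _ _) ⟩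
      (indicator (P? y) + indicator (P? x)) + count P? (xs ∖ x)  ≡⟨ cong (_+ count P? (xs ∖ x)) (+-comm (indicator (P? y)) _) ⟩
      (indicator (P? x) + indicator (P? y)) + count P? (xs ∖ x)  ≡⟨ +-assoc (indicator (P? x)) _ _ ⟩
      indicator (P? x) + (indicator (P? y) + count P? (xs ∖ x))  ≡⟨ cong (indicator (P? x) +_) (sym (count-∷ P? y (xs ∖ x))) ⟩
      indicator (P? x) + count P? (y ∷ (xs ∖ x))                 ≡⟨ cong (λ zs → indicator (P? x) + count P? zs) (sym (filter-accept (λ z → ¬? (z ≟ x)) (All.lookup y≢ x∈))) ⟩
      indicator (P? x) + count P? ((y ∷ xs) ∖ x)                 ∎
      where open ≡-Reasoning

    length-∖ : ∀ {x xs} → x ∈ xs → length (xs ∖ x) < length xs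
    length-∖ {x} {xs} x∈ = filter-notAll (λ y → ¬? (y ≟ x)) xs (Any.map (λ { refl f → f refl }) x∈)

  length-∖-≤ : ∀ {x xs k} → x ∈ xs → length xs ≤ⁿ suc k → length (xs ∖ x) ≤ⁿ k
  length-∖-≤ x∈ le = s≤s⁻¹ (≤-trans (length-∖ x∈) le)

  _[_↦_] : {B : Set} → (A → B) → A → B → A → B
  (f [ x ↦ b ]) y with y ≟ x
  ... | yes _ = b
  ... | no  _ = f y

  update-≡ : {B : Set} (f : A → B) → ∀ x b → (f [ x ↦ b ]) x ≡ b
  update-≡ f x b with x ≟ x
  ... | yes _  = refl
  ... | no x≢x = contradiction refl x≢x

  update-≢ : {B : Set} (f : A → B) → ∀ {x y} b → y ≢ x → (f [ x ↦ b ]) y ≡ f y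
  update-≢ f {x} {y} b y≢x with y ≟ x
  ... | yes eq = contradiction eq y≢x
  ... | no  _  = refl

  -- Successive updates do not interfere, as `xs` has no repetitions; `d` only supplies the values
  -- off `xs`.
  interpolate : {B : Set} → (A → B) → ∀ {xs} (ys : List B) → Unique xs → length xs ≡ length ys →
    ∃[ g ] map g xs ≡ ys
  interpolate d {[]}     []       _       _  = d , refl
  interpolate d {x ∷ xs} (y ∷ ys) (x≢ ∷ u) eq with interpolate d ys u (suc-injective eq)
  ... | g , refl = g [ x ↦ y ] ,
    cong₂ _∷_ (update-≡ g x y) (map-cong-local (All.map (λ ne → update-≢ g y (ne ∘ sym)) x≢))

-- Trees as edge lists grown leaf by leaf.

module Trees {V : Set} (_≟_ : DecidableEquality V) where
  open Removal _≟_

  Edges : Set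
  Edges = List (V × V)

  deg : Edges → V → ℕ
  deg []            w = 0
  deg ((a , c) ∷ E) w = indicator (a ≟ w) + (indicator (c ≟ w) + deg E w)

  infix 4 _~[_]_ _≋_
  _~[_]_ : V → Edges → V → Set
  a ~[ E ] c = (a , c) ∈ E ⊎ (c , a) ∈ E

  -- Holds for lists that differ only in the order and orientation of their edges. Degrees select
  -- the next leaf and adjacency identifies the tree, so the coding sees nothing else.
  record _≋_ (E F : Edges) : Set where
    field
      deg-≡ : ∀ w → deg E w ≡ deg F w
      to    : ∀ {a c} → a ~[ E ] c → a ~[ F ] c
      from  : ∀ {a c} → a ~[ F ] c → a ~[ E ] c
  open _≋_ public

  ≋-refl : ∀ {E} → E ≋ E
  ≋-refl = record { deg-≡ = λ _ → refl ; to = id ; from = id }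

  ≋-trans : ∀ {E F H} → E ≋ F → F ≋ H → E ≋ H
  ≋-trans p q = record
    { deg-≡ = λ w → trans (deg-≡ p w) (deg-≡ q w) ; to = to q ∘ to p ; from = from p ∘ from q }

  ~-cons : ∀ {E F e} → (∀ {a c} → a ~[ E ] c → a ~[ F ] c) →
           ∀ {a c} → a ~[ e ∷ E ] c → a ~[ e ∷ F ] c
  ~-cons f (inj₁ (here eq)) = inj₁ (here eq)
  ~-cons f (inj₂ (here eq)) = inj₂ (here eq)
  ~-cons f (inj₁ (there i)) = ⊎-map there there (f (inj₁ i))
  ~-cons f (inj₂ (there i)) = ⊎-map there there (f (inj₂ i))

  ≋-cons : ∀ {E F} e → E ≋ F → e ∷ E ≋ e ∷ F
  ≋-cons (a , c) p = record
    { deg-≡ = λ w → cong (λ d → indicator (a ≟ w) + (indicator (c ≟ w) + d)) (deg-≡ p w)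
    ; to = ~-cons (to p) ; from = ~-cons (from p) }

  ∈-swap : ∀ {e f z : V × V} {E : Edges} → z ∈ e ∷ f ∷ E → z ∈ f ∷ e ∷ E
  ∈-swap (here eq)         = there (here eq)
  ∈-swap (there (here eq)) = here eq
  ∈-swap (there (there i)) = there (there i)

  ≋-swap : ∀ {E} e f → e ∷ f ∷ E ≋ f ∷ e ∷ E
  ≋-swap {E} (a , c) (a′ , c′) = record
    { deg-≡ = λ w → let p = indicator (a ≟ w)
                        q = indicator (c ≟ w)
                        r = indicator (a′ ≟ w)
                        s = indicator (c′ ≟ w)
                        d = deg E w
                        open ≡-Reasoning in begin
        p + (q + (r + (s + d)))  ≡⟨ sym (+-assoc p q _) ⟩
        (p + q) + (r + (s + d))  ≡⟨ cong ((p + q) +_) (sym (+-assoc r s d)) ⟩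
        (p + q) + ((r + s) + d)  ≡⟨ sym (+-assoc (p + q) (r + s) d) ⟩
        ((p + q) + (r + s)) + d  ≡⟨ cong (_+ d) (+-comm (p + q) (r + s)) ⟩
        ((r + s) + (p + q)) + d  ≡⟨ +-assoc (r + s) (p + q) d ⟩
        (r + s) + ((p + q) + d)  ≡⟨ cong ((r + s) +_) (+-assoc p q d) ⟩
        (r + s) + (p + (q + d))  ≡⟨ +-assoc r s _ ⟩
        r + (s + (p + (q + d)))  ∎
    ; to = ⊎-map ∈-swap ∈-swap ; from = ⊎-map ∈-swap ∈-swap }

  ~-flip : ∀ {x y a c} → a ~[ (x , y) ∷ [] ] c → a ~[ (y , x) ∷ [] ] c
  ~-flip (inj₁ (here refl)) = inj₂ (here refl)
  ~-flip (inj₂ (here refl)) = inj₁ (here refl)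

  ≋-flip : ∀ x y → (x , y) ∷ [] ≋ (y , x) ∷ []
  ≋-flip x y = record
    { deg-≡ = λ w → let p = indicator (x ≟ w)
                        q = indicator (y ≟ w)
                    in trans (cong (p +_) (+-identityʳ q))
                         (trans (+-comm p q) (cong (q +_) (sym (+-identityʳ p))))
    ; to = ~-flip ; from = ~-flip }

  deg-cons-child : ∀ u p E → p ≢ u → deg ((u , p) ∷ E) u ≡ suc (deg E u)
  deg-cons-child u p E p≢u =
    cong₂ _+_ (indicator-yes (u ≟ u) refl) (cong (_+ deg E u) (indicator-no (p ≟ u) p≢u))

  deg-cons-parent : ∀ u p E → p ≢ u → deg ((u , p) ∷ E) p ≡ suc (deg E p)
  deg-cons-parent u p E p≢u =
    cong₂ _+_ (indicator-no (u ≟ p) (p≢u ∘ sym)) (cong (_+ deg E p) (indicator-yes (p ≟ p) refl))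

  deg-cons-other : ∀ {u p w} E → w ≢ u → w ≢ p → deg ((u , p) ∷ E) w ≡ deg E w
  deg-cons-other {u} {p} {w} E w≢u w≢p =
    cong₂ _+_ (indicator-no (u ≟ w) (w≢u ∘ sym)) (cong (_+ deg E w) (indicator-no (p ≟ w) (w≢p ∘ sym)))

  deg-cons-≥ : ∀ u p E w → deg E w ≤ⁿ deg ((u , p) ∷ E) w
  deg-cons-≥ u p E w = ≤-trans (m≤n+m _ (indicator (p ≟ w))) (m≤n+m _ (indicator (u ≟ w)))

  -- Trees on the set of entries of `S`: a single vertex, or a leaf `u` hung on a vertex `p` of a
  -- smaller tree. Statements on degrees and leaves become inductions that avoid walks and cycles.
  data Tree : List V → Edges → Set where
    single : ∀ {S x} → x ∈ S → (∀ {y} → y ∈ S → y ≡ x) → Tree S []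
    grow   : ∀ {S E u p} → u ∈ S → p ∈ S ∖ u → Tree (S ∖ u) E → Tree S ((u , p) ∷ E)

  tree-cong : ∀ {S S′ E} → (∀ {x} → x ∈ S → x ∈ S′) → (∀ {x} → x ∈ S′ → x ∈ S) → Tree S E → Tree S′ E
  tree-cong f g (single x∈ all≡) = single (f x∈) (all≡ ∘ g)
  tree-cong {S} {S′} f g (grow {u = u} u∈ p∈ t) = grow (f u∈) (f∖ p∈) (tree-cong f∖ g∖ t)
    where
    f∖ : ∀ {x} → x ∈ S ∖ u → x ∈ S′ ∖ u
    f∖ x∈ = let (i , ne) = ∈-∖⁻ x∈ in ∈-∖⁺ (f i) ne
    g∖ : ∀ {x} → x ∈ S′ ∖ u → x ∈ S ∖ u
    g∖ x∈ = let (i , ne) = ∈-∖⁻ x∈ in ∈-∖⁺ (g i) ne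

  tree-deg-∉ : ∀ {S E w} → Tree S E → w ∉ S → deg E w ≡ 0
  tree-deg-∉ (single _ _) _ = refl
  tree-deg-∉ (grow {E = E} u∈ p∈ t) w∉ =
    trans (deg-cons-other E (λ { refl → w∉ u∈ }) (λ { refl → w∉ (proj₁ (∈-∖⁻ p∈)) }))
      (tree-deg-∉ t (w∉ ∘ proj₁ ∘ ∈-∖⁻))

  tree-deg-≥1 : ∀ {S E w y} → Tree S E → w ∈ S → y ∈ S → w ≢ y → 1 ≤ⁿ deg E w
  tree-deg-≥1 (single _ all≡) w∈ y∈ w≢y = contradiction (trans (all≡ w∈) (sym (all≡ y∈))) w≢y
  tree-deg-≥1 {w = w} (grow {E = E} {u} {p} u∈ p∈ t) w∈ _ _ with w ≟ u | w ≟ p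
  ... | yes refl | _ = ≤-trans (s≤s z≤n) (≤-reflexive (sym (deg-cons-child u p E (proj₂ (∈-∖⁻ p∈)))))
  ... | no _ | yes refl = ≤-trans (s≤s z≤n) (≤-reflexive (sym (deg-cons-parent u p E (proj₂ (∈-∖⁻ p∈)))))
  ... | no w≢u | no w≢p = ≤-trans (tree-deg-≥1 t (∈-∖⁺ w∈ w≢u) p∈ w≢p) (deg-cons-≥ u p E w)

  singleton⇒edgeless : ∀ {S E p} → (∀ {y} → y ∈ S → y ≡ p) → Tree S E → E ≡ []
  singleton⇒edgeless _ (single _ _) = refl
  singleton⇒edgeless all≡ (grow u∈ p∈ _) =
    let (i , ne) = ∈-∖⁻ p∈ in contradiction (trans (all≡ i) (sym (all≡ u∈))) ne

  other? : ∀ S p → (∃[ y ] y ∈ S × y ≢ p) ⊎ (∀ {y} → y ∈ S → y ≡ p)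
  other? S p with any? (λ y → ¬? (y ≟ p)) S
  ... | yes a = inj₁ (find a)
  ... | no ¬a = inj₂ λ {y} y∈ → case y ≟ p of λ
    { (yes eq) → eq ; (no ne) → contradiction (lose y∈ ne) ¬a }

  Leaf : Edges → V → Set
  Leaf E w = deg E w ≡ 1

  leaf? : ∀ E → Decidable (Leaf E)
  leaf? E w = deg E w ≟ℕ 1

  child-leaf : ∀ {S E u p} → p ∈ S ∖ u → Tree (S ∖ u) E → Leaf ((u , p) ∷ E) u
  child-leaf {E = E} {u} {p} p∈ t =
    trans (deg-cons-child u p E (proj₂ (∈-∖⁻ p∈))) (cong suc (tree-deg-∉ t (λ i → proj₂ (∈-∖⁻ i) refl)))

  -- The leaf `u` grown last serves unless `u` is `z`. In that case a leaf of the smaller tree other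
  -- than `p` keeps its degree, and if `p` is alone there, `p` itself is a leaf. Applied twice, this
  -- gives two leaves.
  leaf-avoiding : ∀ {S E x y} → Tree S E → x ∈ S → y ∈ S → x ≢ y → ∀ z → ∃[ w ] w ∈ S × w ≢ z × Leaf E w
  leaf-avoiding (single _ all≡) x∈ y∈ x≢y _ = contradiction (trans (all≡ x∈) (sym (all≡ y∈))) x≢y
  leaf-avoiding {S} (grow {E = E} {u} {p} u∈ p∈ t) _ _ _ z with u ≟ z
  ... | no u≢z = u , u∈ , u≢z , child-leaf p∈ t
  ... | yes refl with other? (S ∖ u) p
  ...   | inj₁ (y , y∈ , y≢p) with leaf-avoiding t y∈ p∈ y≢p p
  ...     | w , w∈ , w≢p , leaf =
    let (i , w≢u) = ∈-∖⁻ w∈ in w , i , w≢u , trans (deg-cons-other E w≢u w≢p) leaf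
  leaf-avoiding {S} (grow {E = E} {u} {p} u∈ p∈ t) _ _ _ z | yes refl | inj₂ all≡
    with singleton⇒edgeless all≡ t
  ... | refl = let (i , p≢u) = ∈-∖⁻ p∈ in p , i , p≢u , deg-cons-parent u p [] p≢u

  -- Any leaf can be taken as the one grown last. A leaf other than `u` and `p` is removed from the
  -- smaller tree by induction and its edge moved to the front; if the leaf is `p`, the tree is the
  -- single edge, which is reversed.
  remove-leaf : ∀ {S E w} → Tree S E → w ∈ S → Leaf E w →
    ∃₂ λ p E′ → p ∈ S ∖ w × Tree (S ∖ w) E′ × E ≋ (w , p) ∷ E′
  remove-leaf {S} {w = w} (grow {E = E} {u} {p} u∈ p∈ t) w∈ leaf with w ≟ u
  ... | yes refl = p , E , p∈ , t , ≋-refl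
  ... | no w≢u with w ≟ p
  ...   | no w≢p with remove-leaf t (∈-∖⁺ w∈ w≢u) (trans (sym (deg-cons-other E w≢u w≢p)) leaf)
  ...     | q , E′ , q∈ , t′ , eqv =
    q , (u , p) ∷ E′ , proj₁ (∈-∖⁻ (f q∈)) ,
    grow (∈-∖⁺ u∈ (w≢u ∘ sym)) (f (∈-∖⁺ p∈ (w≢p ∘ sym))) (tree-cong f g t′) ,
    ≋-trans (≋-cons (u , p) eqv) (≋-swap (u , p) (w , q))
    where
    f : ∀ {x} → x ∈ S ∖ u ∖ w → x ∈ S ∖ w ∖ u
    f x∈ = let (i , x≢w) = ∈-∖⁻ x∈ ; (j , x≢u) = ∈-∖⁻ i in ∈-∖⁺ (∈-∖⁺ j x≢w) x≢u
    g : ∀ {x} → x ∈ S ∖ w ∖ u → x ∈ S ∖ u ∖ w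
    g x∈ = let (i , x≢u) = ∈-∖⁻ x∈ ; (j , x≢w) = ∈-∖⁻ i in ∈-∖⁺ (∈-∖⁺ j x≢u) x≢w
  remove-leaf {S} {w = w} (grow {E = E} {u} {p} u∈ p∈ t) w∈ leaf | no w≢u | yes refl with other? (S ∖ u) p
  -- Here the leaf is `p`: a further vertex `y` would give `p` an edge in the smaller tree besides
  -- the edge to `u`, hence degree at least 2.
  ... | inj₁ (y , y∈ , y≢p) = contradiction
    (≤-trans (s≤s (tree-deg-≥1 t p∈ y∈ (y≢p ∘ sym)))
      (≤-reflexive (trans (sym (deg-cons-parent u p E w≢u)) leaf)))
    λ { (s≤s ()) }
  ... | inj₂ all≡ with singleton⇒edgeless all≡ t
  ...   | refl = u , [] , ∈-∖⁺ u∈ (w≢u ∘ sym) ,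
    single (∈-∖⁺ u∈ (w≢u ∘ sym)) (λ {y} y∈ → let (i , y≢p) = ∈-∖⁻ y∈ in case y ≟ u of λ
      { (yes eq) → eq ; (no y≢u) → contradiction (all≡ (∈-∖⁺ i y≢u)) y≢p }) ,
    ≋-flip u p

  tree-on-two : ∀ {S E x y} → Tree S E → x ∈ S → y ∈ S → x ≢ y →
    (∀ {z} → z ∈ S → z ≡ x ⊎ z ≡ y) → E ≋ (x , y) ∷ []
  tree-on-two (single _ all≡) x∈ y∈ x≢y _ = contradiction (trans (all≡ x∈) (sym (all≡ y∈))) x≢y
  tree-on-two {S} {x = x} {y} (grow {E = E} {u} {p} u∈ p∈ t) x∈ y∈ x≢y cover
    with ∈-∖⁻ p∈
  ... | p∈S , p≢u with cover u∈ | cover p∈S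
  ... | inj₁ refl | inj₁ refl = contradiction refl p≢u
  ... | inj₂ refl | inj₂ refl = contradiction refl p≢u
  ... | inj₁ refl | inj₂ refl
    with refl ← singleton⇒edgeless {p = y} (λ i → let (j , ne) = ∈-∖⁻ i in [ (λ eq → contradiction eq ne) , id ]′ (cover j)) t
    = ≋-refl
  ... | inj₂ refl | inj₁ refl
    with refl ← singleton⇒edgeless {p = x} (λ i → let (j , ne) = ∈-∖⁻ i in [ id , (λ eq → contradiction eq ne) ]′ (cover j)) t
    = ≋-flip y x

-- The code of a tree and its decoding.

module PruferCode {V B : Set} (_≟_ : DecidableEquality V) (_≟ᴮ_ : DecidableEquality B) (b : V → B) where
  open Trees _≟_
  open Removal _≟_
  open DecMembership _≟_ using (_∈?_)

  _≟ᴹ_ : DecidableEquality (Maybe B)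
  _≟ᴹ_ = Maybe-≡-dec _≟ᴮ_

  private
    module K = Removal _≟ᴹ_
    module Bl = Removal _≟ᴮ_

  NonLast : List V → V → Set
  NonLast S u = Any (λ w → w ≢ u × b w ≡ b u) S

  nonLast? : ∀ S → Decidable (NonLast S)
  nonLast? S u = any? (λ w → ¬? (w ≟ u) ×-dec (b w ≟ᴮ b u)) S

  movable? : ∀ E S → Decidable (λ w → Leaf E w × NonLast S w)
  movable? E S w = leaf? E w ×-dec nonLast? S w

  -- The head of this list is the leaf deleted next.
  candidates : Edges → List V → List V
  candidates E S = filter (movable? E S) S ++ filter (leaf? E) S

  -- The choice of the next leaf depends on the tree only through its set of leaves, so encoding and
  -- decoding make the same choice.
  candidates-cong : ∀ {E F} S → (∀ {w} → Leaf E w → Leaf F w) → (∀ {w} → Leaf F w → Leaf E w) →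
    candidates E S ≡ candidates F S
  candidates-cong {E} {F} S f g = cong₂ _++_
    (filter-≐ (movable? E S) (movable? F S) ((λ (l , n) → f l , n) , (λ (l , n) → g l , n)) S)
    (filter-≐ (leaf? E) (leaf? F) (f , g) S)

  -- The queue that records the neighbour of a deleted leaf u lying in another block:
  -- that of the block of u or, if u is the last vertex of its block, the common one.
  data Key (S : List V) (u : V) : Maybe B → Set where
    nonLast : NonLast S u → Key S u (just (b u))
    last    : ¬ NonLast S u → Key S u nothing

  key-unique : ∀ {S u k k′} → Key S u k → Key S u k′ → k ≡ k′
  key-unique (nonLast _)  (nonLast _)  = refl
  key-unique (nonLast n)  (last ¬n)    = contradiction n ¬n
  key-unique (last ¬n)    (nonLast n)  = contradiction n ¬n
  key-unique (last _)     (last _)     = refl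

  key : ∀ S u → ∃ (Key S u)
  key S u with nonLast? S u
  ... | yes n = just (b u) , nonLast n
  ... | no ¬n = nothing , last ¬n

  -- A pattern keeps the neighbours that lie in the same block as the deleted leaf.
  Pattern Queues : Set
  Pattern = V → Maybe V
  Queues  = Maybe B → List V

  -- The record of one deletion, with `Q` the queues before it and `Q′` those left for later
  -- deletions. The value `nothing` of the pattern at `u` marks an open slot, and queues are
  -- consumed from the front.
  data Entry (S : List V) (u p : V) (π : Pattern) (Q Q′ : Queues) : Set where
    internal : π u ≡ just p → b p ≡ b u → (∀ k → Q k ≡ Q′ k) → Entry S u p π Q Q′
    external : ∀ {k} → π u ≡ nothing → b p ≢ b u → Key S u k → Q k ≡ p ∷ Q′ k →
               (∀ {j} → j ≢ k → Q j ≡ Q′ j) → Entry S u p π Q Q′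

  -- A relation between recorded data and a tree whose edges are listed in order of deletion.
  -- Encoding is then existence of the data, decoding is determinism of the edges. The two final
  -- vertices record no neighbour and are open slots.
  data Code : List V → Pattern → Queues → Edges → Set where
    base : ∀ {S π Q x y} → x ∈ S → y ∈ S → b x ≢ b y → (∀ {z} → z ∈ S → z ≡ x ⊎ z ≡ y) →
           (∀ {z} → z ∈ S → π z ≡ nothing) → (∀ k → Q k ≡ []) → Code S π Q ((x , y) ∷ [])
    step : ∀ {S π π′ Q Q′ E u p} → u ∈ S → p ∈ S ∖ u →
           (∃[ rest ] candidates ((u , p) ∷ E) S ≡ u ∷ rest) →
           (∀ {z} → z ∈ S ∖ u → π z ≡ π′ z) → Entry S u p π Q Q′ →
           Code (S ∖ u) π′ Q′ E → Code S π Q ((u , p) ∷ E)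

  code-deg-∉ : ∀ {S π Q E w} → Code S π Q E → w ∉ S → deg E w ≡ 0
  code-deg-∉ (base x∈ y∈ _ _ _ _) w∉ = deg-cons-other [] (λ { refl → w∉ x∈ }) (λ { refl → w∉ y∈ })
  code-deg-∉ (step {E = E} u∈ p∈ _ _ _ c) w∉ =
    trans (deg-cons-other E (λ { refl → w∉ u∈ }) (λ { refl → w∉ (proj₁ (∈-∖⁻ p∈)) }))
      (code-deg-∉ c (w∉ ∘ proj₁ ∘ ∈-∖⁻))

  base-leaf : ∀ {x y w} → x ≢ y → w ≡ x ⊎ w ≡ y → Leaf ((x , y) ∷ []) w
  base-leaf {x} {y} x≢y (inj₁ refl) = deg-cons-child x y [] (x≢y ∘ sym)
  base-leaf {x} {y} x≢y (inj₂ refl) = deg-cons-parent x y [] (x≢y ∘ sym)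

  code-deg-∈ : ∀ {S π Q E w} → Code S π Q E → w ∈ S → 1 ≤ⁿ deg E w
  code-deg-∈ (base _ _ bx≢by cover _ _) w∈ =
    ≤-reflexive (sym (base-leaf (bx≢by ∘ cong b) (cover w∈)))
  code-deg-∈ {w = w} (step {E = E} {u} {p} u∈ p∈ _ _ _ c) w∈ with w ≟ u
  ... | yes refl = ≤-trans (s≤s z≤n) (≤-reflexive (sym (deg-cons-child u p E (proj₂ (∈-∖⁻ p∈)))))
  ... | no w≢u   = ≤-trans (code-deg-∈ c (∈-∖⁺ w∈ w≢u)) (deg-cons-≥ u p E w)

  -- As for Prüfer codes, the vertices of `S` among the recorded neighbours are exactly those of
  -- degree at least 2; the two inclusions follow below.
  Appears : List V → Pattern → Queues → V → Set
  Appears S π Q w = (∃[ x ] x ∈ S × π x ≡ just w) ⊎ (∃[ k ] w ∈ Q k)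

  appears-cong : ∀ {S π π′ Q Q′ w} → (∀ {z} → z ∈ S → π z ≡ π′ z) → (∀ k → Q k ≡ Q′ k) →
    Appears S π Q w → Appears S π′ Q′ w
  appears-cong f g (inj₁ (x , x∈ , eq)) = inj₁ (x , x∈ , trans (sym (f x∈)) eq)
  appears-cong f g (inj₂ (k , w∈))      = inj₂ (k , subst (_ ∈_) (g k) w∈)

  appears-step⁻ : ∀ {S u p π π′ Q Q′ w} → (∀ {z} → z ∈ S ∖ u → π z ≡ π′ z) → Entry S u p π Q Q′ →
    Appears S π Q w → w ≡ p ⊎ Appears (S ∖ u) π′ Q′ w
  appears-step⁻ {u = u} agree entry (inj₁ (x , x∈ , eq)) with x ≟ u
  ... | no x≢u = inj₂ (inj₁ (x , ∈-∖⁺ x∈ x≢u , trans (sym (agree (∈-∖⁺ x∈ x≢u))) eq))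
  appears-step⁻ agree (internal πu _ _) (inj₁ (x , x∈ , eq)) | yes refl =
    inj₁ (just-injective (trans (sym eq) πu))
  appears-step⁻ agree (external πu _ _ _ _) (inj₁ (x , x∈ , eq)) | yes refl with () ← trans (sym eq) πu
  appears-step⁻ agree (internal _ _ same) (inj₂ (k , w∈)) = inj₂ (inj₂ (k , subst (_ ∈_) (same k) w∈))
  appears-step⁻ agree (external {k} _ _ _ Qk same) (inj₂ (j , w∈)) with j ≟ᴹ k
  ... | no j≢k = inj₂ (inj₂ (j , subst (_ ∈_) (same j≢k) w∈))
  ... | yes refl with subst (_ ∈_) Qk w∈
  ...   | here eq  = inj₁ eq
  ...   | there w∈′ = inj₂ (inj₂ (k , w∈′))

  appears-step⁺ : ∀ {S u p π π′ Q Q′ w} → u ∈ S → (∀ {z} → z ∈ S ∖ u → π z ≡ π′ z) → Entry S u p π Q Q′ →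
    w ≡ p ⊎ Appears (S ∖ u) π′ Q′ w → Appears S π Q w
  appears-step⁺ u∈ agree (internal πu _ _) (inj₁ refl) = inj₁ (_ , u∈ , πu)
  appears-step⁺ u∈ agree (external {k} _ _ _ Qk _) (inj₁ refl) = inj₂ (k , subst (_ ∈_) (sym Qk) (here refl))
  appears-step⁺ u∈ agree entry (inj₂ (inj₁ (x , x∈ , eq))) =
    inj₁ (x , proj₁ (∈-∖⁻ x∈) , trans (agree x∈) eq)
  appears-step⁺ u∈ agree (internal _ _ same) (inj₂ (inj₂ (k , w∈))) = inj₂ (k , subst (_ ∈_) (sym (same k)) w∈)
  appears-step⁺ u∈ agree (external {k} _ _ _ Qk same) (inj₂ (inj₂ (j , w∈))) with j ≟ᴹ k
  ... | no j≢k   = inj₂ (j , subst (_ ∈_) (sym (same j≢k)) w∈)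
  ... | yes refl = inj₂ (k , subst (_ ∈_) (sym Qk) (there w∈))

  ¬appears-base : ∀ {S π Q w} → (∀ {z} → z ∈ S → π z ≡ nothing) → (∀ k → Q k ≡ []) → ¬ Appears S π Q w
  ¬appears-base none empty (inj₁ (x , x∈ , eq)) with () ← trans (sym eq) (none x∈)
  ¬appears-base none empty (inj₂ (k , w∈)) with () ← subst (_ ∈_) (empty k) w∈

  -- When `p` is recorded it loses the edge to `u` but survives, and every surviving vertex has
  -- another edge in the smaller tree.
  appears⇒deg≥2 : ∀ {S π Q E w} → Code S π Q E → Appears S π Q w → 2 ≤ⁿ deg E w
  appears⇒deg≥2 (base _ _ _ _ none empty) app = contradiction app (¬appears-base none empty)
  appears⇒deg≥2 {w = w} (step {E = E} {u} {p} u∈ p∈ _ agree entry c) app with appears-step⁻ agree entry app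
  ... | inj₁ refl = ≤-trans (s≤s (code-deg-∈ c p∈)) (≤-reflexive (sym (deg-cons-parent u p E (proj₂ (∈-∖⁻ p∈)))))
  ... | inj₂ app′ = ≤-trans (appears⇒deg≥2 c app′) (deg-cons-≥ u p E w)

  leaf-or-appears : ∀ {S π Q E w} → Code S π Q E → w ∈ S → Leaf E w ⊎ Appears S π Q w
  leaf-or-appears (base _ _ bx≢by cover _ _) w∈ = inj₁ (base-leaf (bx≢by ∘ cong b) (cover w∈))
  leaf-or-appears {w = w} (step {E = E} {u} {p} u∈ p∈ _ agree entry c) w∈ with w ≟ u
  ... | yes refl = inj₁ (trans (deg-cons-child u p E (proj₂ (∈-∖⁻ p∈)))
                               (cong suc (code-deg-∉ c (λ i → proj₂ (∈-∖⁻ i) refl))))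
  ... | no w≢u with w ≟ p
  ...   | yes refl = inj₂ (appears-step⁺ u∈ agree entry (inj₁ refl))
  ...   | no w≢p with leaf-or-appears c (∈-∖⁺ w∈ w≢u)
  ...     | inj₁ leaf = inj₁ (trans (deg-cons-other E w≢u w≢p) leaf)
  ...     | inj₂ app  = inj₂ (appears-step⁺ u∈ agree entry (inj₂ app))

  -- The leaves can be read off the code: they are the vertices that do not appear in it.
  leaf-transfer : ∀ {S π π₁ Q Q₁ E E₁ w} → (∀ {z} → z ∈ S → π z ≡ π₁ z) → (∀ k → Q k ≡ Q₁ k) →
    Code S π Q E → Code S π₁ Q₁ E₁ → Leaf E w → Leaf E₁ w
  leaf-transfer {S} {w = w} f g c c₁ leaf with w ∈? S
  ... | no w∉ with () ← trans (sym leaf) (code-deg-∉ c w∉)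
  ... | yes w∈ with leaf-or-appears c₁ w∈
  ...   | inj₁ leaf₁ = leaf₁
  ...   | inj₂ app = contradiction
    (≤-trans (appears⇒deg≥2 c (appears-cong (sym ∘ f) (sym ∘ g) app)) (≤-reflexive leaf))
    λ { (s≤s ()) }

  -- The pattern at `u` either is the neighbour or marks it as external. In the second case the key,
  -- which depends on `S` and `u` only, names the queue that has the neighbour at its head.
  entry-deterministic : ∀ {S u p p₁ π π₁ Q Q₁ Q′ Q₁′} → π u ≡ π₁ u → (∀ k → Q k ≡ Q₁ k) →
    Entry S u p π Q Q′ → Entry S u p₁ π₁ Q₁ Q₁′ → p ≡ p₁ × (∀ k → Q′ k ≡ Q₁′ k)
  entry-deterministic eq g (internal πu _ same) (internal πu₁ _ same₁) =
    just-injective (trans (sym πu) (trans eq πu₁)) , λ k → trans (sym (same k)) (trans (g k) (same₁ k))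
  entry-deterministic eq g (internal πu _ _) (external πu₁ _ _ _ _) with () ← trans (sym πu) (trans eq πu₁)
  entry-deterministic eq g (external πu _ _ _ _) (internal πu₁ _ _) with () ← trans (sym πu) (trans eq πu₁)
  entry-deterministic {Q′ = Q′} {Q₁′} eq g (external {k} _ _ κ Qk same) (external _ _ κ₁ Qk₁ same₁)
    with refl ← key-unique κ κ₁ = ∷-injectiveˡ heads , rest
    where
    heads = trans (sym Qk) (trans (g k) Qk₁)
    rest : ∀ j → Q′ j ≡ Q₁′ j
    rest j with j ≟ᴹ k
    ... | yes refl = ∷-injectiveʳ heads
    ... | no j≢k   = trans (sym (same j≢k)) (trans (g j) (same₁ j≢k))

  ¬base-step : ∀ {S u p π Q Q′} → u ∈ S → (∀ {z} → z ∈ S → π z ≡ nothing) → (∀ k → Q k ≡ []) → ¬ Entry S u p π Q Q′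
  ¬base-step u∈ none empty (internal πu _ _) with () ← trans (sym πu) (none u∈)
  ¬base-step u∈ none empty (external {k} _ _ _ Qk _) with () ← trans (sym Qk) (empty k)

  -- Decoding: equal data give equal leaves, hence the same deleted leaf, the same neighbour and
  -- again equal data. Only adjacency is compared, since the final edge may be written in either
  -- orientation.
  code-deterministic : ∀ {S π π₁ Q Q₁ E E₁} → (∀ {z} → z ∈ S → π z ≡ π₁ z) → (∀ k → Q k ≡ Q₁ k) →
    Code S π Q E → Code S π₁ Q₁ E₁ → ∀ {a c} → a ~[ E ] c → a ~[ E₁ ] c
  code-deterministic f g (base x∈ y∈ bx≢by cover _ _) (base x₁∈ y₁∈ bx₁≢by₁ cover₁ _ _)
    with cover₁ x∈ | cover₁ y∈
  ... | inj₁ refl | inj₁ refl = contradiction refl bx≢by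
  ... | inj₁ refl | inj₂ refl = id
  ... | inj₂ refl | inj₁ refl = ~-flip
  ... | inj₂ refl | inj₂ refl = contradiction refl bx≢by
  code-deterministic f g (base _ _ _ _ none empty) (step u∈ _ _ _ entry _) = contradiction entry
    (¬base-step u∈ (λ z∈ → trans (sym (f z∈)) (none z∈)) (λ k → trans (sym (g k)) (empty k)))
  code-deterministic f g (step u∈ _ _ _ entry _) (base _ _ _ _ none empty) = contradiction entry
    (¬base-step u∈ (λ z∈ → trans (f z∈) (none z∈)) (λ k → trans (g k) (empty k)))
  code-deterministic {S} f g c@(step {E = E} {u} {p} u∈ _ (_ , sel) agree entry c′)
                             c₁@(step {E = E₁} {u₁} {p₁} u₁∈ _ (_ , sel₁) agree₁ entry₁ c₁′)
    with refl ← ∷-injectiveˡ (trans (sym sel) (trans (candidates-cong {(u , p) ∷ E} {(u₁ , p₁) ∷ E₁} S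
                  (leaf-transfer f g c c₁) (leaf-transfer (sym ∘ f) (sym ∘ g) c₁ c)) sel₁))
    with refl , g′ ← entry-deterministic (f u∈) g entry entry₁ =
    ~-cons (code-deterministic (λ z∈ → trans (sym (agree z∈)) (trans (f (proj₁ (∈-∖⁻ z∈))) (agree₁ z∈))) g′ c′ c₁′)

  -- Encoding of trees whose vertices meet at least two blocks.

  TwoBlocks : List V → Set
  TwoBlocks S = ∃₂ λ x y → x ∈ S × y ∈ S × b x ≢ b y

  represented : ∀ {S u x} → NonLast S u → x ∈ S → ∃[ x′ ] x′ ∈ S ∖ u × b x′ ≡ b x
  represented {u = u} {x} n x∈ with x ≟ u | find n
  ... | no x≢u   | _                      = x , ∈-∖⁺ x∈ x≢u , refl
  ... | yes refl | w , w∈ , w≢u , bw≡bu = w , ∈-∖⁺ w∈ w≢u , bw≡bu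

  twoBlocks-∖ : ∀ {S u} → NonLast S u → TwoBlocks S → TwoBlocks (S ∖ u)
  twoBlocks-∖ n (x , y , x∈ , y∈ , bx≢by) with represented n x∈ | represented n y∈
  ... | x′ , x′∈ , eqx | y′ , y′∈ , eqy =
    x′ , y′ , x′∈ , y′∈ , λ eq → bx≢by (trans (sym eqx) (trans eq eqy))

  alone : ∀ {S x z} → ¬ NonLast S x → z ∈ S → z ≢ x → b z ≢ b x
  alone ¬n z∈ z≢x eq = ¬n (lose z∈ (z≢x , eq))

  third? : ∀ S x y → (∃[ z ] z ∈ S × z ≢ x × z ≢ y) ⊎ (∀ {z} → z ∈ S → z ≡ x ⊎ z ≡ y)
  third? S x y with any? (λ z → ¬? (z ≟ x) ×-dec ¬? (z ≟ y)) S
  ... | yes a = inj₁ (find a)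
  ... | no ¬a = inj₂ λ {z} z∈ → case z ≟ x of λ
    { (yes eq) → inj₁ eq
    ; (no z≢x) → case z ≟ y of λ
      { (yes eq) → inj₂ eq ; (no z≢y) → contradiction (lose z∈ (z≢x , z≢y)) ¬a } }

  twoBlocks-three : ∀ {S} u {x y z} → x ∈ S → y ∈ S → z ∈ S → b x ≢ b y → b x ≢ b z → b y ≢ b z → TwoBlocks (S ∖ u)
  twoBlocks-three u {x} {y} {z} x∈ y∈ z∈ xy xz yz with x ≟ u | y ≟ u
  ... | yes refl | _        = y , z , ∈-∖⁺ y∈ (xy ∘ sym ∘ cong b) , ∈-∖⁺ z∈ (xz ∘ sym ∘ cong b) , yz
  ... | no x≢u   | yes refl = x , z , ∈-∖⁺ x∈ x≢u , ∈-∖⁺ z∈ (yz ∘ sym ∘ cong b) , xz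
  ... | no x≢u   | no y≢u   = x , y , ∈-∖⁺ x∈ x≢u , ∈-∖⁺ y∈ y≢u , xy

  -- The coded list `F` is the given tree with its edges rearranged in order of deletion.
  Encoding : List V → Edges → Set
  Encoding S E = ∃[ π ] ∃[ Q ] ∃[ F ] Code S π Q F × E ≋ F

  -- The data are built backwards: the record of `u` is put in front of the data already found for
  -- the smaller tree.
  entry : ∀ S u p π′ Q′ → ∃₂ λ π Q → (∀ {z} → z ∈ S ∖ u → π z ≡ π′ z) × Entry S u p π Q Q′
  entry S u p π′ Q′ with b p ≟ᴮ b u
  ... | yes eq = π′ [ u ↦ just p ] , Q′ , (λ z∈ → update-≢ π′ _ (proj₂ (∈-∖⁻ z∈))) ,
    internal (update-≡ π′ u _) eq (λ _ → refl)
  ... | no ne = let (k , κ) = key S u in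
    π′ [ u ↦ nothing ] , Q′ K.[ k ↦ p ∷ Q′ k ] , (λ z∈ → update-≢ π′ _ (proj₂ (∈-∖⁻ z∈))) ,
    external (update-≡ π′ u _) ne κ (K.update-≡ Q′ k _) (K.update-≢ Q′ _)

  encode-step : ∀ {S E u rest} → Tree S E → u ∈ S → Leaf E u → candidates E S ≡ u ∷ rest →
    (∀ {E′} → Tree (S ∖ u) E′ → Encoding (S ∖ u) E′) → Encoding S E
  encode-step {S} {E} {u} t u∈ leaf sel ih with remove-leaf t u∈ leaf
  ... | p , E′ , p∈ , t′ , E≋ with ih t′
  ... | π′ , Q′ , F , c , E′≋F with entry S u p π′ Q′
  ... | π , Q , agree , ent = π , Q , (u , p) ∷ F , step u∈ p∈ sel′ agree ent c , E≋F
    where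
    E≋F = ≋-trans E≋ (≋-cons (u , p) E′≋F)
    -- The leaf was selected in `E`; the rearranged list has the same degrees, so it selects the
    -- same leaf.
    sel′ = _ , trans (candidates-cong {(u , p) ∷ F} {E} S (trans (deg-≡ E≋F _)) (trans (sym (deg-≡ E≋F _)))) sel

  private
    head-∈ : {P : V → Set} (P? : Decidable P) → ∀ {S u rest} → filter P? S ≡ u ∷ rest → u ∈ S × P u
    head-∈ P? eq = ∈-filter⁻ P? (subst (_ ∈_) (sym eq) (here refl))

    none-∈ : {P : V → Set} (P? : Decidable P) → ∀ {S w} → filter P? S ≡ [] → w ∈ S → ¬ P w
    none-∈ P? eq w∈ Pw with () ← subst (_ ∈_) eq (∈-filter⁺ P? w∈ Pw)

  -- If every leaf is the last of its block, two leaves x and y lie in distinct blocks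
  -- and any third vertex lies in a third one. Hence two blocks survive each deletion,
  -- and the process ends with two adjacent vertices, for which nothing is recorded.
  encode : ∀ k {S E} → length S ≤ⁿ k → Tree S E → TwoBlocks S → Encoding S E
  encode zero {[]} _ _ (_ , _ , () , _)
  encode (suc k) {S} {E} S≤ t two@(x₀ , y₀ , x₀∈ , y₀∈ , ne) with filter (movable? E S) S in eq₁
  ... | u ∷ _ = let (u∈ , leaf , n) = head-∈ (movable? E S) eq₁ in
    encode-step t u∈ leaf (cong (_++ filter (leaf? E) S) eq₁)
      (λ t′ → encode k (length-∖-≤ u∈ S≤) t′ (twoBlocks-∖ n two))
  ... | [] with leaf-avoiding t x₀∈ y₀∈ (ne ∘ cong b) x₀
  ...   | x , x∈ , _ , leafx with leaf-avoiding t x₀∈ y₀∈ (ne ∘ cong b) x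
  ...   | y , y∈ , y≢x , leafy with third? S x y
  ...   | inj₂ cover =
    (λ _ → nothing) , (λ _ → []) , _ ,
    base x∈ y∈ (alone (λ n → none-∈ (movable? E S) eq₁ x∈ (leafx , n)) y∈ y≢x ∘ sym) cover (λ _ → refl) (λ _ → refl) ,
    tree-on-two t x∈ y∈ (y≢x ∘ sym) cover
  ...   | inj₁ (z , z∈ , z≢x , z≢y) with filter (leaf? E) S in eq₂
  ...     | [] = contradiction leafx (none-∈ (leaf? E) eq₂ x∈)
  ...     | u ∷ _ = let (u∈ , leaf) = head-∈ (leaf? E) eq₂ in
    encode-step t u∈ leaf (cong₂ _++_ eq₁ eq₂) (λ t′ → encode k (length-∖-≤ u∈ S≤) t′
      (twoBlocks-three u x∈ y∈ z∈
        (alone ¬nx y∈ y≢x ∘ sym) (alone ¬nx z∈ z≢x ∘ sym) (alone ¬ny z∈ z≢y ∘ sym)))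
    where
    ¬nx : ¬ NonLast S x
    ¬nx n = none-∈ (movable? E S) eq₁ x∈ (leafx , n)
    ¬ny : ¬ NonLast S y
    ¬ny n = none-∈ (movable? E S) eq₁ y∈ (leafy , n)

  -- Lengths of the queues and position of their entries.

  external? : ∀ (π : Pattern) i → Decidable (λ w → b w ≡ i × π w ≡ nothing)
  external? π i w = (b w ≟ᴮ i) ×-dec Maybe-≡-dec _≟_ (π w) nothing

  Present : List V → B → Set
  Present S i = Any (λ w → b w ≡ i) S

  present? : ∀ S → Decidable (Present S)
  present? S i = any? (λ w → b w ≟ᴮ i) S

  present-∖⁻ : ∀ {S u i} → Present (S ∖ u) i → Present S i
  present-∖⁻ a = let (w , w∈ , eq) = find a in lose (proj₁ (∈-∖⁻ w∈)) eq

  present-nonLast : ∀ {S u i} → NonLast S u → Present S i → Present (S ∖ u) i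
  present-nonLast n a =
    let (w , w∈ , eq) = find a
        (w′ , w′∈ , eq′) = represented n w∈
    in lose w′∈ (trans eq′ eq)

  present-other : ∀ {S u i} → i ≢ b u → Present S i → Present (S ∖ u) i
  present-other i≢ a = let (w , w∈ , eq) = find a in
    lose (∈-∖⁺ w∈ λ { refl → i≢ (sym eq) }) eq

  absent-last : ∀ {S u} → ¬ NonLast S u → ¬ Present (S ∖ u) (b u)
  absent-last ¬n a = let (w , w∈ , eq) = find a ; (i , ne) = ∈-∖⁻ w∈ in ¬n (lose i (ne , eq))

  internal⇒nonLast : ∀ {S u p} → p ∈ S ∖ u → b p ≡ b u → NonLast S u
  internal⇒nonLast p∈ eq = let (i , ne) = ∈-∖⁻ p∈ in lose i (ne , eq)

  private
    present-≡ : ∀ {S u} i → (Present S i → Present (S ∖ u) i) →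
      indicator (present? (S ∖ u) i) ≡ indicator (present? S i)
    present-≡ {S} {u} i f = indicator-cong (present? (S ∖ u) i) (present? S i) present-∖⁻ f

  -- One step of the invariant for block `i`: open slots equal queue entries plus 1 if the block is
  -- still present. An external non-last vertex of the block accounts for one slot and one queue
  -- entry; an external last vertex accounts for one slot and for the disappearance of the block.
  external-count-step : ∀ {S u p π Q Q′} → u ∈ S → p ∈ S ∖ u → Entry S u p π Q Q′ → ∀ i →
    indicator (external? π i u) + (length (Q′ (just i)) + indicator (present? (S ∖ u) i))
      ≡ length (Q (just i)) + indicator (present? S i)
  external-count-step {S} {u} {π = π} u∈ p∈ (internal πu bp same) i =
    cong₂ _+_ {y = 0} (indicator-no (external? π i u) λ (_ , e) → case trans (sym πu) e of λ ())
      (cong₂ _+_ (cong length (sym (same (just i)))) (present-≡ i (present-nonLast (internal⇒nonLast p∈ bp))))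
  external-count-step {S} {u} {π = π} u∈ p∈ (external πu _ (nonLast n) Qk same) i with i ≟ᴮ b u
  ... | yes refl =
    trans (cong₂ _+_ (indicator-yes (external? π i u) (refl , πu))
                     (cong (_ +_) (present-≡ i (present-nonLast n))))
          (cong (_+ indicator (present? S i)) (sym (cong length Qk)))
  ... | no i≢ =
    cong₂ _+_ {y = 0} (indicator-no (external? π i u) λ (e , _) → i≢ (sym e))
      (cong₂ _+_ (cong length (sym (same λ e → i≢ (just-injective e)))) (present-≡ i (present-nonLast n)))
  external-count-step {S} {u} {π = π} {Q′ = Q′} u∈ p∈ (external πu _ (last ¬n) Qk same) i with i ≟ᴮ b u
  ... | yes refl = begin
    indicator (external? π i u) + (length (Q′ (just i)) + indicator (present? (S ∖ u) i))
      ≡⟨ cong₂ _+_ (indicator-yes (external? π i u) (refl , πu))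
           (cong₂ _+_ (cong length (sym (same λ ()))) (indicator-no (present? (S ∖ u) i) (absent-last ¬n))) ⟩
    suc (_ + 0)  ≡⟨ sym (+-suc _ 0) ⟩
    _ + 1        ≡⟨ cong (_ +_) (sym (indicator-yes (present? S i) (lose u∈ refl))) ⟩
    _            ∎
    where open ≡-Reasoning
  ... | no i≢ =
    cong₂ _+_ {y = 0} (indicator-no (external? π i u) λ (e , _) → i≢ (sym e))
      (cong₂ _+_ (cong length (sym (same λ ()))) (present-≡ i (present-other i≢)))

  external-count : ∀ {S π Q E} → Code S π Q E → Unique S → ∀ i →
    count (external? π i) S ≡ length (Q (just i)) + indicator (present? S i)
  external-count {S} {π} {Q} (base {x = x} {y} x∈ y∈ ne cover none empty) uniq i = begin
    count X? S                                      ≡⟨ count-∖ X? uniq x∈ ⟩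
    indicator (X? x) + count X? (S ∖ x)             ≡⟨ cong (indicator (X? x) +_) (count-∖ X? (∖-unique uniq) y∈′) ⟩
    indicator (X? x) + (indicator (X? y) + count X? (S ∖ x ∖ y))
      ≡⟨ cong (λ d → indicator (X? x) + (indicator (X? y) + d)) (count-none X? λ z∈ → contradiction (∈-∖⁻ z∈) gone) ⟩
    indicator (X? x) + (indicator (X? y) + 0)       ≡⟨ both ⟩
    indicator (present? S i)                        ≡⟨ cong (λ l → length l + indicator (present? S i)) (sym (empty (just i))) ⟩
    length (Q (just i)) + indicator (present? S i)  ∎
    where
    open ≡-Reasoning
    X? = external? π i
    y∈′ : y ∈ S ∖ x
    y∈′ = ∈-∖⁺ y∈ λ { refl → ne refl }
    gone : ∀ {z} → ¬ (z ∈ S ∖ x × z ≢ y)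
    gone (z∈ , z≢y) = let (i , z≢x) = ∈-∖⁻ z∈ in [ z≢x , z≢y ]′ (cover i)
    -- The final vertices `x` and `y` are open and lie in different blocks, so block `i` has one
    -- open slot if it is one of these two blocks and none otherwise.
    both : indicator (X? x) + (indicator (X? y) + 0) ≡ indicator (present? S i)
    both with b x ≟ᴮ i
    ... | yes refl = trans (cong₂ _+_ (indicator-yes (yes refl ×-dec Maybe-≡-dec _≟_ (π x) nothing) (refl , none x∈))
                              (cong (_+ 0) (indicator-no (X? y) (λ (e , _) → ne (sym e)))))
                           (sym (indicator-yes (present? S i) (lose x∈ refl)))
    ... | no bx≢ with b y ≟ᴮ i
    ...   | yes refl = trans (cong (_+ 0) (indicator-yes (yes refl ×-dec Maybe-≡-dec _≟_ (π y) nothing) (refl , none y∈)))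
                           (sym (indicator-yes (present? S i) (lose y∈ refl)))
    ...   | no by≢ = sym (indicator-no (present? S i) λ a → let (z , z∈ , e) = find a in
              [ (λ { refl → bx≢ e }) , (λ { refl → by≢ e }) ]′ (cover z∈))
  external-count {S} {π} (step {π′ = π′} u∈ p∈ _ agree entry c) uniq i =
    trans (count-∖ (external? π i) uniq u∈)
      (trans (cong (indicator (external? π i _) +_)
        (trans (count-cong (external? π i) (external? π′ i) _
                  (λ z∈ (e , n) → e , trans (sym (agree z∈)) n) (λ z∈ (e , n) → e , trans (agree z∈) n))
               (external-count c (∖-unique uniq) i)))
        (external-count-step u∈ p∈ entry i))

  -- The common queue gains an entry exactly when a block disappears, and two blocks are left at the
  -- end.
  common-length : ∀ {S π Q E} → Code S π Q E → ∀ {bs} → Unique bs → (∀ i → i ∈ bs) →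
    2 + length (Q nothing) ≡ count (present? S) bs
  common-length {S} (base {x = x} {y} x∈ y∈ ne cover _ empty) {bs} uniq all∈ = begin
    2 + _  ≡⟨ cong (λ l → 2 + length l) (empty nothing) ⟩
    2 + 0  ≡⟨ cong₂ (λ m n → m + (n + 0)) (sym (indicator-yes (present? S (b x)) (lose x∈ refl))) (sym (indicator-yes (present? S (b y)) (lose y∈ refl))) ⟩
    indicator (present? S (b x)) + (indicator (present? S (b y)) + 0)
      ≡⟨ cong (λ d → indicator (present? S (b x)) + (indicator (present? S (b y)) + d))
           (sym (count-none (present? S) λ i∈ a → let (i∈′ , i≢y) = Bl.∈-∖⁻ i∈ ; (z , z∈ , e) = find a in
             [ (λ { refl → proj₂ (Bl.∈-∖⁻ i∈′) (sym e) }) , (λ { refl → i≢y (sym e) }) ]′ (cover z∈))) ⟩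
    indicator (present? S (b x)) + (indicator (present? S (b y)) + count (present? S) (bs Bl.∖ b x Bl.∖ b y))
      ≡⟨ cong (indicator (present? S (b x)) +_)
           (sym (Bl.count-∖ (present? S) (Bl.∖-unique uniq) (Bl.∈-∖⁺ (all∈ (b y)) (ne ∘ sym)))) ⟩
    indicator (present? S (b x)) + count (present? S) (bs Bl.∖ b x)
      ≡⟨ sym (Bl.count-∖ (present? S) uniq (all∈ (b x))) ⟩
    count (present? S) bs ∎
    where open ≡-Reasoning
  common-length {S} (step {u = u} u∈ p∈ _ _ (internal _ bp same) c) {bs} uniq all∈ =
    trans (cong (λ l → 2 + length l) (same nothing))
      (trans (common-length c uniq all∈)
        (count-cong (present? (S ∖ u)) (present? S) bs (λ _ → present-∖⁻)
          (λ _ → present-nonLast (internal⇒nonLast p∈ bp))))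
  common-length {S} (step {u = u} u∈ p∈ _ _ (external _ _ (nonLast n) _ same) c) {bs} uniq all∈ =
    trans (cong (λ l → 2 + length l) (same λ ()))
      (trans (common-length c uniq all∈)
        (count-cong (present? (S ∖ u)) (present? S) bs (λ _ → present-∖⁻) (λ _ → present-nonLast n)))
  common-length {S} (step {u = u} u∈ p∈ _ _ (external _ _ (last ¬n) Qk _) c) {bs} uniq all∈ = begin
    2 + _                                ≡⟨ cong (λ l → 2 + length l) Qk ⟩
    suc (2 + _)                          ≡⟨ cong suc (common-length c uniq all∈) ⟩
    suc (count (present? (S ∖ u)) bs)    ≡⟨ cong suc (Bl.count-∖ (present? (S ∖ u)) uniq (all∈ (b u))) ⟩
    suc (indicator (present? (S ∖ u) (b u)) + count (present? (S ∖ u)) (bs Bl.∖ b u))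
      ≡⟨ cong suc (cong₂ _+_ (indicator-no (present? (S ∖ u) (b u)) (absent-last ¬n))
           (count-cong (present? (S ∖ u)) (present? S) _ (λ _ → present-∖⁻)
             (λ i∈ → present-other (proj₂ (Bl.∈-∖⁻ i∈))))) ⟩
    1 + count (present? S) (bs Bl.∖ b u)
      ≡⟨ cong (_+ count (present? S) (bs Bl.∖ b u)) (sym (indicator-yes (present? S (b u)) (lose u∈ refl))) ⟩
    indicator (present? S (b u)) + count (present? S) (bs Bl.∖ b u)
      ≡⟨ sym (Bl.count-∖ (present? S) uniq (all∈ (b u))) ⟩
    count (present? S) bs                ∎
    where open ≡-Reasoning

  -- Ensures that a slot filled from the queue of its block points outside that block, so it cannot
  -- be mistaken for an internal neighbour.
  queue-external : ∀ {S π Q E} → Code S π Q E → ∀ {i w} → w ∈ Q (just i) → b w ≢ i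
  queue-external (base _ _ _ _ _ empty) {i} w∈ with () ← subst (_ ∈_) (empty (just i)) w∈
  queue-external (step _ _ _ _ (internal _ _ same) c) {i} w∈ = queue-external c (subst (_ ∈_) (same (just i)) w∈)
  queue-external (step _ _ _ _ (external {k} _ ne κ Qk same) c) {i} w∈ with just i ≟ᴹ k
  ... | no i≢k = queue-external c (subst (_ ∈_) (same i≢k) w∈)
  ... | yes refl with subst (_ ∈_) Qk w∈
  ...   | there w∈′ = queue-external c w∈′
  queue-external (step _ _ _ _ (external _ ne (nonLast _) Qk same) c) w∈ | yes refl | here refl = ne

  pattern-internal : ∀ {S π Q E} → Code S π Q E → ∀ {w y} → w ∈ S → π w ≡ just y → b y ≡ b w × w ~[ E ] y
  pattern-internal (base _ _ _ _ none _) w∈ eq with () ← trans (sym eq) (none w∈)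
  pattern-internal (step {u = u} _ _ _ agree entry c) {w} w∈ eq with w ≟ u
  ... | no w≢u = let w∈′ = ∈-∖⁺ w∈ w≢u
                     (e , adj) = pattern-internal c w∈′ (trans (sym (agree w∈′)) eq)
                 in e , ⊎-map there there adj
  pattern-internal (step _ _ _ _ (internal πu bp _) _) w∈ eq | yes refl
    with refl ← just-injective (trans (sym eq) πu) = bp , inj₁ (here refl)
  pattern-internal (step _ _ _ _ (external πu _ _ _ _) _) w∈ eq | yes refl with () ← trans (sym eq) πu

-- From connected acyclic graphs to grown edge lists.

module SpanningTree (G : FinGraph) (T : List (FinGraph.V G × FinGraph.V G)) where
  private
    module G = FinGraph G
    module H = FinGraph (G ↾ T)
  open Trees G._≟_
  open Removal G._≟_
  open DecMembership G._≟_ using (_∈?_)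
  open DecMembership (≡-dec G._≟_ G._≟_) using () renaming (_∈?_ to _∈ᴱ?_)

  crossing : ∀ {S a xs z} → H.Walk a xs z → a ∈ S → z ∉ S → ∃₂ λ p u → p ∈ S × u ∉ S × p H.~ u
  crossing H.[] a∈ z∉ = contradiction a∈ z∉
  crossing {S} (H._∷_ {x = x} e walk) a∈ z∉ with x ∈? S
  ... | yes x∈ = crossing walk x∈ z∉
  ... | no x∉  = _ , x , a∈ , x∉ , e

  -- While a vertex is missing, a walk to it leaves `S` along some edge, which is added to the tree.
  -- The list `U` contains all vertices outside `S`, and its length bounds the number of rounds.
  extend : H.Connected → ∀ k {S U E r} → Tree S E → (∀ {a c} → a ~[ E ] c → a H.~ c) → r ∈ S →
    (∀ x → x ∈ S ⊎ x ∈ U) → length U ≤ⁿ k →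
    ∃[ F ] Tree G.vertices F × (∀ {a c} → a ~[ F ] c → a H.~ c)
  extend conn k {S} {U} {E} t sub r∈ cover U≤ with any? (λ z → ¬? (z ∈? S)) G.vertices
  ... | no ¬a = E , tree-cong (λ {x} _ → G.complete x) all∈ t , sub
    where
    all∈ : ∀ {x} → x ∈ G.vertices → x ∈ S
    all∈ {x} x∈ = case x ∈? S of λ { (yes i) → i ; (no x∉) → contradiction (lose x∈ x∉) ¬a }
  ... | yes a with find a
  ...   | z , _ , z∉ with crossing (proj₂ (conn _ z)) r∈ z∉
  ...   | p , u , p∈ , u∉ , p~u = next k U≤
    where
    u∈U : u ∈ U
    u∈U = [ (λ u∈ → contradiction u∈ u∉) , id ]′ (cover u)
    ≢u : ∀ {x} → x ∈ S → x ≢ u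
    ≢u x∈ refl = u∉ x∈
    t′ : Tree (u ∷ S) ((u , p) ∷ E)
    t′ = grow (here refl) (∈-∖⁺ (there p∈) (≢u p∈))
      (tree-cong (λ x∈ → ∈-∖⁺ (there x∈) (≢u x∈))
        (λ x∈ → case ∈-∖⁻ x∈ of λ { (here eq , ne) → contradiction eq ne ; (there i , _) → i }) t)
    sub′ : ∀ {a c} → a ~[ (u , p) ∷ E ] c → a H.~ c
    sub′ (inj₁ (here refl)) = H.~-sym p~u
    sub′ (inj₂ (here refl)) = p~u
    sub′ (inj₁ (there i))   = sub (inj₁ i)
    sub′ (inj₂ (there i))   = sub (inj₂ i)
    cover′ : ∀ x → x ∈ u ∷ S ⊎ x ∈ U ∖ u
    cover′ x with x G.≟ u | cover x
    ... | yes eq | _       = inj₁ (here eq)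
    ... | no _   | inj₁ x∈ = inj₁ (there x∈)
    ... | no ne  | inj₂ x∈ = inj₂ (∈-∖⁺ x∈ ne)
    next : ∀ k → length U ≤ⁿ k → ∃[ F ] Tree G.vertices F × (∀ {a c} → a ~[ F ] c → a H.~ c)
    next zero    U≤ with () ← ≤-trans (length-∖ u∈U) U≤
    next (suc k) U≤ = extend conn k t′ sub′ (there r∈) cover′ (length-∖-≤ u∈U U≤)

  tree-connected : ∀ {S E a c} → Tree S E → a ∈ S → c ∈ S → Star (_~[ E ]_) a c
  tree-connected (single _ all≡) a∈ c∈ with refl ← all≡ a∈ with refl ← all≡ c∈ = ε
  tree-connected {a = a} {c} (grow {E = E} {u} {p} u∈ p∈ t) a∈ c∈ with a G.≟ u | c G.≟ u
  ... | yes refl | yes refl = ε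
  ... | yes refl | no c≢u   = inj₁ (here refl) ◅ Star.map (⊎-map there there) (tree-connected t p∈ (∈-∖⁺ c∈ c≢u))
  ... | no a≢u   | yes refl = Star.map (⊎-map there there) (tree-connected t (∈-∖⁺ a∈ a≢u) p∈) ◅◅ (inj₂ (here refl) ◅ ε)
  ... | no a≢u   | no c≢u   = Star.map (⊎-map there there) (tree-connected t (∈-∖⁺ a∈ a≢u) (∈-∖⁺ c∈ c≢u))

  module _ {F} (t : Tree G.vertices F) (sub : ∀ {a c} → a ~[ F ] c → a H.~ c) where
    private module K = FinGraph (G ↾ F)

    star⇒walk : ∀ {a c} → Star (_~[ F ]_) a c → ∃[ xs ] K.Walk a xs c
    star⇒walk ε       = [] , K.[]
    star⇒walk (e ◅ s) = let (xs , w) = star⇒walk s in _ , (proj₁ (sub e) , e) K.∷ w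

    walk-sub : ∀ {a xs c} → K.Walk a xs c → H.Walk a xs c
    walk-sub K.[]            = H.[]
    walk-sub ((_ , e) K.∷ w) = sub e H.∷ walk-sub w

    -- The grown tree contains a path between the ends of the edge. If the edge were not in `F`,
    -- this path would have at least two edges, and the edge would close it to a cycle.
    acyclic⇒⊆ : H.Acyclic → ∀ {a c} → a H.~ c → a ~[ F ] c
    acyclic⇒⊆ acyclic {a} {c} a~c with ((a , c) ∈ᴱ? F) ⊎-dec ((c , a) ∈ᴱ? F)
    ... | yes e = e
    ... | no ¬e with K.walk⇒path (proj₂ (star⇒walk (tree-connected t (G.complete a) (G.complete c))))
    ...   | [] , K.[] , _ = contradiction a~c H.~-irrefl
    ...   | x ∷ [] , ((_ , e) K.∷ K.[]) , _ = contradiction e ¬e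
    ...   | xs@(_ ∷ _ ∷ _) , walk , distinct =
      contradiction (a , c , xs , walk-sub walk , distinct , s≤s (s≤s z≤n) , H.~-sym a~c) acyclic

  isTree⇒tree : H.IsTree → G.V → ∃[ F ] Tree G.vertices F ×
    (∀ {a c} → a ~[ F ] c → a H.~ c) × (∀ {a c} → a H.~ c → a ~[ F ] c)
  isTree⇒tree (conn , acyclic) r
    with extend conn (length G.vertices) {S = r ∷ []} (single (here refl) (λ { (here eq) → eq }))
           (λ { (inj₁ ()) ; (inj₂ ()) }) (here refl) (inj₂ ∘ G.complete) ≤-refl
  ... | F , t , sub = F , t , sub , acyclic⇒⊆ t sub acyclic

-- Choice lists, sublists and pairs of a repetition-free list.

∈-choices⁻ : DecidableEquality A → (A → B) → (F : A → List B) → ∀ {xs ys} → Unique xs →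
  ys ∈ choices (map F xs) → ∃[ g ] map g xs ≡ ys × (∀ {x} → x ∈ xs → g x ∈ F x)
∈-choices⁻ _≟_ d F {[]} _ (here refl) = d , refl , λ ()
∈-choices⁻ {A = A} _≟_ d F {x ∷ xs} (x≢ ∷ u) ys∈ with ∈-cartesianProductWith⁻ _∷_ (F x) (choices (map F xs)) ys∈
... | y , ys , y∈ , ys∈′ , refl with ∈-choices⁻ _≟_ d F u ys∈′
... | g , refl , g∈ = g [ x ↦ y ] ,
  cong₂ _∷_ (update-≡ g x y) (map-cong-local (All.map (λ ne → update-≢ g y (ne ∘ sym)) x≢)) , mem
  where
  open Removal _≟_
  mem : ∀ {z} → z ∈ x ∷ xs → (g [ x ↦ y ]) z ∈ F z
  mem (here refl) = subst (_∈ F x) (sym (update-≡ g x y)) y∈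
  mem (there z∈)  = subst (_∈ F _) (sym (update-≢ g y λ { refl → All.lookup x≢ z∈ refl })) (g∈ z∈)

sublists-⊆ : ∀ {L T : List A} → T ∈ sublists L → ∀ {x} → x ∈ T → x ∈ L
sublists-⊆ {L = []} (here refl) ()
sublists-⊆ {L = y ∷ L} T∈ x∈ with ∈-++⁻ (sublists L) T∈
... | inj₁ T∈′ = there (sublists-⊆ T∈′ x∈)
... | inj₂ T∈′ with ∈-map⁻ (y ∷_) T∈′
sublists-⊆ {L = y ∷ L} T∈ (here eq)  | inj₂ T∈′ | T′ , T′∈ , refl = here eq
sublists-⊆ {L = y ∷ L} T∈ (there x∈) | inj₂ T∈′ | T′ , T′∈ , refl = there (sublists-⊆ T′∈ x∈)

sublists-unique : ∀ {L : List A} → Unique L → Unique (sublists L)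
sublists-unique [] = [] ∷ []
sublists-unique {L = y ∷ L} u@(_ ∷ uL) =
  Unique.++⁺ (sublists-unique uL) (Unique.map⁺ ∷-injectiveʳ (sublists-unique uL))
    λ (T∈ , T∈′) → case ∈-map⁻ (y ∷_) T∈′ of λ { (_ , _ , refl) → unique-∉ u (sublists-⊆ T∈ (here refl)) }

-- A sublist inherits the order of `L`, so its set of entries determines it; edge sets are thereby
-- counted once each.
sublists-ext : ∀ {L T T′ : List A} → Unique L → T ∈ sublists L → T′ ∈ sublists L →
  (∀ {x} → x ∈ T → x ∈ T′) → (∀ {x} → x ∈ T′ → x ∈ T) → T ≡ T′
sublists-ext {L = []} _ (here refl) (here refl) _ _ = refl
sublists-ext {L = y ∷ L} u@(_ ∷ uL) T∈ T′∈ f g with ∈-++⁻ (sublists L) T∈ | ∈-++⁻ (sublists L) T′∈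
... | inj₁ i | inj₁ j = sublists-ext uL i j f g
... | inj₁ i | inj₂ j with ∈-map⁻ (y ∷_) j
...   | _ , _ , refl = contradiction (sublists-⊆ i (g (here refl))) (unique-∉ u)
sublists-ext {L = y ∷ L} u@(_ ∷ uL) T∈ T′∈ f g | inj₂ i | inj₁ j with ∈-map⁻ (y ∷_) i
... | _ , _ , refl = contradiction (sublists-⊆ j (f (here refl))) (unique-∉ u)
sublists-ext {L = y ∷ L} u@(_ ∷ uL) T∈ T′∈ f g | inj₂ i | inj₂ j
  with ∈-map⁻ (y ∷_) i | ∈-map⁻ (y ∷_) j
... | S , S∈ , refl | S′ , S′∈ , refl = cong (y ∷_) (sublists-ext uL S∈ S′∈ (strip S∈ f) (strip S′∈ g))
  where
  strip : ∀ {P P′} → P ∈ sublists L → (∀ {x} → x ∈ y ∷ P → x ∈ y ∷ P′) → ∀ {x} → x ∈ P → x ∈ P′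
  strip P∈ h x∈ with h (there x∈)
  ... | here refl = contradiction (sublists-⊆ P∈ x∈) (unique-∉ u)
  ... | there x∈′ = x∈′

pairs-∈ : ∀ {xs : List A} {a c} → (a , c) ∈ pairs xs → a ∈ xs × c ∈ xs
pairs-∈ {xs = x ∷ xs} e with ∈-++⁻ (map (x ,_) xs) e
... | inj₂ e′ = let (a∈ , c∈) = pairs-∈ e′ in there a∈ , there c∈
... | inj₁ e′ with ∈-map⁻ (x ,_) e′
...   | _ , c∈ , refl = here refl , there c∈

pairs-unique : ∀ {xs : List A} → Unique xs → Unique (pairs xs)
pairs-unique [] = []
pairs-unique {xs = x ∷ xs} u@(_ ∷ uxs) =
  Unique.++⁺ (Unique.map⁺ (λ { refl → refl }) uxs) (pairs-unique uxs)
    λ (e , e′) → case ∈-map⁻ (x ,_) e of λ { (_ , _ , refl) → unique-∉ u (proj₁ (pairs-∈ e′)) }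

-- The first component of a pair precedes the second in `xs`. Hence adjacency alone determines which
-- listed edges belong to a tree.
pairs-asym : ∀ {xs : List A} {a c} → Unique xs → (a , c) ∈ pairs xs → (c , a) ∉ pairs xs
pairs-asym {xs = x ∷ xs} u@(_ ∷ uxs) e e′ with ∈-++⁻ (map (x ,_) xs) e | ∈-++⁻ (map (x ,_) xs) e′
... | inj₂ i | inj₂ j = pairs-asym uxs i j
... | inj₁ i | inj₁ j with ∈-map⁻ (x ,_) i | ∈-map⁻ (x ,_) j
...   | _ , c∈ , refl | _ , a∈ , refl = unique-∉ u c∈
pairs-asym {xs = x ∷ xs} u@(_ ∷ uxs) e e′ | inj₁ i | inj₂ j with ∈-map⁻ (x ,_) i
...   | _ , c∈ , refl = unique-∉ u (proj₂ (pairs-∈ j))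
pairs-asym {xs = x ∷ xs} u@(_ ∷ uxs) e e′ | inj₂ i | inj₁ j with ∈-map⁻ (x ,_) j
...   | _ , c∈ , refl = unique-∉ u (proj₂ (pairs-∈ i))

-- The counting bound for a graph divided into blocks.

two-distinct : ∀ {n} → 2 ≤ⁿ n → ∃₂ λ (i j : Fin n) → i ≢ j
two-distinct (s≤s (s≤s _)) = zero , suc zero , λ ()

-- The form in which the product enters: `n` nonempty blocks with all vertices of different blocks
-- adjacent.
module BlockGraph (G : FinGraph) {n : ℕ} (n≥2 : 2 ≤ⁿ n) (b : FinGraph.V G → Fin n)
  (b-surjective : ∀ i → ∃[ u ] b u ≡ i)
  (cross : ∀ {u w} → b u ≢ b w → FinGraph._~_ G u w) where

  open FinGraph G
  open Trees _≟_
  open Removal _≟_ using (interpolate)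
  open PruferCode _≟_ _≟ᶠ_ b

  outside : Fin n → List V
  outside i = filter (λ w → ¬? (b w ≟ᶠ i)) vertices

  neighbours : V → List V
  neighbours u = filter (u ~?_) vertices

  trees : List (List (V × V))
  trees = filter (λ T → FinGraph.isTree? (G ↾ T)) (sublists (edges G))

  edges-unique : Unique (edges G)
  edges-unique = Unique.filter⁺ _ (pairs-unique unique)

  edges-asym : ∀ {a c} → (a , c) ∈ edges G → (c , a) ∉ edges G
  edges-asym e e′ = pairs-asym unique (proj₁ (∈-filter⁻ _ e)) (proj₁ (∈-filter⁻ _ e′))

  edges-~ : ∀ {a c} → (a , c) ∈ edges G → a ~ c
  edges-~ e = proj₂ (∈-filter⁻ (λ (u , w) → u ~? w) {xs = pairs vertices} e)

  spanning-ext : ∀ {T T′} → T ∈ sublists (edges G) → T′ ∈ sublists (edges G) →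
    (∀ {a c} → a ~[ T ] c → a ~[ T′ ] c) → (∀ {a c} → a ~[ T′ ] c → a ~[ T ] c) → T ≡ T′
  spanning-ext T∈ T′∈ f g = sublists-ext edges-unique T∈ T′∈ (oriented T∈ T′∈ f) (oriented T′∈ T∈ g)
    where
    oriented : ∀ {T T′} → T ∈ sublists (edges G) → T′ ∈ sublists (edges G) →
      (∀ {a c} → a ~[ T ] c → a ~[ T′ ] c) → ∀ {e} → e ∈ T → e ∈ T′
    oriented T∈ T′∈ h e∈ with h (inj₁ e∈)
    ... | inj₁ i = i
    ... | inj₂ i = contradiction (sublists-⊆ T′∈ i) (edges-asym (sublists-⊆ T∈ e∈))

  -- Makes the pattern recoverable from `f`: the value at `u` is kept if it lies in the block of `u`
  -- and erased otherwise.
  Linked : (V → V) → Pattern → Set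
  Linked f π = ∀ u → (∃[ y ] π u ≡ just y × f u ≡ y × b y ≡ b u) ⊎ (π u ≡ nothing × b (f u) ≢ b u)

  linked-unique : ∀ {f f′ π π′} → (∀ u → f u ≡ f′ u) → Linked f π → Linked f′ π′ → ∀ u → π u ≡ π′ u
  linked-unique eq l l′ u with l u | l′ u
  ... | inj₁ (_ , πu , refl , _) | inj₁ (_ , πu′ , refl , _) = trans πu (trans (cong just (eq u)) (sym πu′))
  ... | inj₁ (_ , _ , refl , bi) | inj₂ (_ , be) = contradiction (trans (cong b (sym (eq u))) bi) be
  ... | inj₂ (_ , be) | inj₁ (_ , _ , refl , bi) = contradiction (trans (cong b (eq u)) bi) be
  ... | inj₂ (πu , _) | inj₂ (πu′ , _) = trans πu (sym πu′)

  -- The slots of f that point outside block i hold, in the order of the vertex list,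
  -- the free choice e i followed by the queue of the block.
  record Represents (code : List V × List V) (object : List (V × V) × List V) : Set where
    field
      f        : V → V
      e        : Fin n → V
      π        : Pattern
      Q        : Queues
      F        : Edges
      f-code   : map f vertices ≡ proj₁ code
      Q-code   : Q nothing ≡ proj₂ code
      e-object : map e (allFin n) ≡ proj₂ object
      linked   : Linked f π
      slots    : ∀ i → map f (filter (external? π i) vertices) ≡ e i ∷ Q (just i)
      prufer   : Code vertices π Q F
      T∈       : proj₁ object ∈ sublists (edges G)
      F⇒T      : ∀ {a c} → a ~[ F ] c → a ~[ proj₁ object ] c
      T⇒F      : ∀ {a c} → a ~[ proj₁ object ] c → a ~[ F ] c

  -- Injectivity of the code: `f` determines the pattern, hence the slots; reading `f` along the
  -- slots of block `i` gives `e i` and then the queue; with the common word these determine the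
  -- tree.
  represents-functional : ∀ {c o o′} → Represents c o → Represents c o′ → o ≡ o′
  represents-functional {c} {o} {o′} r r′ = cong₂ _,_
    (spanning-ext R.T∈ R′.T∈
      (R′.F⇒T ∘ code-deterministic (λ {z} _ → π≗ z) Q≗ R.prufer R′.prufer ∘ R.T⇒F)
      (R.F⇒T ∘ code-deterministic (λ {z} _ → sym (π≗ z)) (sym ∘ Q≗) R′.prufer R.prufer ∘ R′.T⇒F))
    (trans (sym R.e-object) (trans (map-cong e≗ (allFin n)) R′.e-object))
    where
    module R = Represents r
    module R′ = Represents r′
    f≗ : ∀ u → R.f u ≡ R′.f u
    f≗ u = map-≡⇒≗ vertices (trans R.f-code (sym R′.f-code)) (complete u)
    π≗ : ∀ u → R.π u ≡ R′.π u
    π≗ = linked-unique f≗ R.linked R′.linked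
    slots≗ : ∀ i → R.e i ∷ R.Q (just i) ≡ R′.e i ∷ R′.Q (just i)
    slots≗ i = begin
      R.e i ∷ R.Q (just i)                                ≡⟨ sym (R.slots i) ⟩
      map R.f (filter (external? R.π i) vertices)         ≡⟨ map-cong f≗ _ ⟩
      map R′.f (filter (external? R.π i) vertices)
        ≡⟨ cong (map R′.f) (filter-≐ (external? R.π i) (external? R′.π i)
             ((λ (p , q) → p , trans (sym (π≗ _)) q) , (λ (p , q) → p , trans (π≗ _) q)) vertices) ⟩
      map R′.f (filter (external? R′.π i) vertices)       ≡⟨ R′.slots i ⟩
      R′.e i ∷ R′.Q (just i)                              ∎
      where open ≡-Reasoning
    e≗ : ∀ i → R.e i ≡ R′.e i
    e≗ i = ∷-injectiveˡ (slots≗ i)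
    Q≗ : ∀ k → R.Q k ≡ R′.Q k
    Q≗ nothing  = trans R.Q-code (sym R′.Q-code)
    Q≗ (just i) = ∷-injectiveʳ (slots≗ i)

  fill : ∀ {π Q F} → Code vertices π Q F → (e : Fin n → V) → (∀ i → b (e i) ≢ i) →
    ∃[ f ] Linked f π × (∀ i → map f (filter (external? π i) vertices) ≡ e i ∷ Q (just i))
  fill {π} {Q} code e e-ext = f , linked , slots
    where
    -- Initially every block is present, so block `i` has one more slot than queue entries, which
    -- makes room for `e i`.
    size : ∀ i → length (filter (external? π i) vertices) ≡ length (e i ∷ Q (just i))
    size i = trans (external-count code unique i)
      (trans (cong (length (Q (just i)) +_)
        (indicator-yes (present? vertices i) (let (u , bu≡i) = b-surjective i in lose (complete u) bu≡i)))
        (+-comm (length (Q (just i))) 1))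
    g : ∀ i → ∃[ h ] map h (filter (external? π i) vertices) ≡ e i ∷ Q (just i)
    g i = interpolate id (e i ∷ Q (just i)) (Unique.filter⁺ (external? π i) unique) (size i)
    f : V → V
    f u = fromMaybe (proj₁ (g (b u)) u) (π u)
    f-nothing : ∀ {u} → π u ≡ nothing → f u ≡ proj₁ (g (b u)) u
    f-nothing {u} eq = cong (fromMaybe _) eq
    slots : ∀ i → map f (filter (external? π i) vertices) ≡ e i ∷ Q (just i)
    slots i = trans (map-cong-local (All.tabulate λ {u} u∈ →
        case ∈-filter⁻ (external? π i) {xs = vertices} u∈ of λ { (_ , refl , πu) → f-nothing πu }))
      (proj₂ (g i))
    e∷Q-external : ∀ {i w} → w ∈ e i ∷ Q (just i) → b w ≢ i
    e∷Q-external {i} (here refl) = e-ext i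
    e∷Q-external (there w∈)  = queue-external code w∈
    linked : Linked f π
    linked u with π u in πu
    ... | just y  = inj₁ (y , refl , refl , proj₁ (pattern-internal code (complete u) πu))
    ... | nothing = inj₂ (refl , e∷Q-external (subst (proj₁ (g (b u)) u ∈_) (proj₂ (g (b u)))
                      (∈-map⁺ (proj₁ (g (b u))) (∈-filter⁺ (external? π (b u)) (complete u) (refl , πu)))))

  extras : List (List V)
  extras = choices (map outside (allFin n))

  codes : List (List V × List V)
  codes = cartesianProduct (choices (map neighbours vertices)) (words (n ∸ 2) vertices)

  twoBlocks : TwoBlocks vertices
  twoBlocks =
    let (i , j , i≢j) = two-distinct n≥2
        (x , bx) = b-surjective i
        (y , by) = b-surjective j
    in x , y , complete x , complete y , λ eq → i≢j (trans (sym bx) (trans eq by))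

  represented-by-code : ∀ {o} → o ∈ cartesianProduct trees extras → ∃[ c ] c ∈ codes × Represents c o
  represented-by-code {T , el} o∈ with ∈-cartesianProduct⁻ trees extras o∈
  ... | T∈trees , el∈ with ∈-filter⁻ (λ T → FinGraph.isTree? (G ↾ T)) {xs = sublists (edges G)} T∈trees
                         -- The vertex `proj₁ twoBlocks` is an arbitrary default value here, and the
                         -- arbitrary root of the grown tree below.
                         | ∈-choices⁻ _≟ᶠ_ (λ _ → proj₁ twoBlocks) outside (Unique.allFin⁺ n) el∈
  ... | T∈ , isTree | e , e-object , e∈
    with SpanningTree.isTree⇒tree G T isTree (proj₁ twoBlocks)
  ... | F₀ , tree , F₀⇒T , T⇒F₀ with encode (length vertices) (≤-reflexive refl) tree twoBlocks
  ... | π , Q , F , code , F₀≋F with fill code e (λ i → proj₂ (∈-filter⁻ (λ w → ¬? (b w ≟ᶠ i)) {xs = vertices} (e∈ (∈-allFin i))))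
  ... | f , linked , slots = (map f vertices , Q nothing) , code∈ , record
    { f = f ; e = e ; π = π ; Q = Q ; F = F
    ; f-code = refl ; Q-code = refl ; e-object = e-object ; linked = linked ; slots = slots
    ; prufer = code ; T∈ = T∈
    ; F⇒T = λ a~c → proj₂ (F₀⇒T (from F₀≋F a~c))
    ; T⇒F = λ a~c → to F₀≋F (T⇒F₀ (adjacent a~c , a~c)) }
    where
    adjacent : ∀ {a c} → a ~[ T ] c → a ~ c
    adjacent (inj₁ i) = edges-~ (sublists-⊆ T∈ i)
    adjacent (inj₂ i) = ~-sym (edges-~ (sublists-⊆ T∈ i))
    -- An internal value is a neighbour in the tree, hence in `G`; an external one lies in another
    -- block and is adjacent by `cross`.
    f∈ : ∀ u → f u ∈ neighbours u
    f∈ u with linked u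
    ... | inj₁ (y , πu , refl , _) = ∈-filter⁺ (u ~?_) (complete (f u))
            (proj₁ (F₀⇒T (from F₀≋F (proj₂ (pattern-internal code (complete u) πu)))))
    ... | inj₂ (_ , ne) = ∈-filter⁺ (u ~?_) (complete (f u)) (cross (ne ∘ sym))
    common : length (Q nothing) ≡ n ∸ 2
    common = cong (_∸ 2) (trans (common-length code (Unique.allFin⁺ n) ∈-allFin)
      (trans (cong length (filter-all (present? vertices) (All.universal
          (λ i → let (u , bu≡i) = b-surjective i in lose (complete u) bu≡i) (allFin n))))
        (length-tabulate {n = n} id)))
    code∈ : (map f vertices , Q nothing) ∈ codes
    code∈ = ∈-cartesianProduct⁺ (∈-choices⁺ neighbours f f∈ vertices)
      (subst (λ k → Q nothing ∈ words k vertices) common (∈-words complete (Q nothing)))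

  τ-bound : τ G *ⁿ ∏ (length ∘ outside) ≤ⁿ order ^ (n ∸ 2) *ⁿ ∏-degrees G
  τ-bound = begin
    τ G *ⁿ ∏ (length ∘ outside)                    ≡⟨ cong (τ G *ⁿ_) (sym length-extras) ⟩
    length trees *ⁿ length extras                  ≡⟨ sym (length-cartesianProductWith _,_ trees extras) ⟩
    length (cartesianProduct trees extras)        ≤⟨ functional⇒length≤ represents-functional codes objects-unique represented-by-code ⟩
    length codes                                  ≡⟨ length-cartesianProductWith _,_ (choices (map neighbours vertices)) _ ⟩
    length (choices (map neighbours vertices)) *ⁿ length (words (n ∸ 2) vertices)
      ≡⟨ cong₂ _*ⁿ_ (trans (length-choices (map neighbours vertices)) (cong product (sym (map-∘ vertices))))
           (length-words (n ∸ 2) vertices) ⟩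
    ∏-degrees G *ⁿ order ^ (n ∸ 2)                 ≡⟨ *-comm (∏-degrees G) _ ⟩
    order ^ (n ∸ 2) *ⁿ ∏-degrees G                 ∎
    where
    open ≤-Reasoning
    length-extras : length extras ≡ ∏ (length ∘ outside)
    length-extras = trans (length-choices (map outside (allFin n)))
      (cong product (trans (sym (map-∘ (allFin n))) (map-tabulate id (length ∘ outside))))
    objects-unique : Unique (cartesianProduct trees extras)
    objects-unique = Unique.cartesianProduct⁺
      (Unique.filter⁺ _ (sublists-unique edges-unique))
      (choices-unique (All.map⁺ (All.universal (λ i → Unique.filter⁺ _ unique) (allFin n))))

-- Orders of the blocks of the product and of their complements.

∑-point : ∀ {n} (g : Fin n → ℕ) i → (∀ j → j ≢ i → g j ≡ 0) → ∑ g ≡ g i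
∑-point g zero    vanish = trans (cong (g zero +_) (∑-zero (g ∘ suc) λ j → vanish (suc j) λ ())) (+-identityʳ _)
  where
  ∑-zero : ∀ {m} (h : Fin m → ℕ) → (∀ j → h j ≡ 0) → ∑ h ≡ 0
  ∑-zero {zero}  h eq = refl
  ∑-zero {suc m} h eq = cong₂ _+_ (eq zero) (∑-zero (h ∘ suc) (eq ∘ suc))
∑-point g (suc i) vanish =
  cong₂ _+_ (vanish zero λ ()) (∑-point (g ∘ suc) i λ j j≢i → vanish (suc j) λ { refl → j≢i refl })

count-concat : {P : A → Set} (P? : Decidable P) → ∀ {n} (g : Fin n → List A) →
  count P? (concat (tabulate g)) ≡ ∑ (count P? ∘ g)
count-concat P? {zero}  g = refl
count-concat P? {suc n} g = trans (cong length (filter-++ P? (g zero) _))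
  (trans (length-++ (filter P? (g zero))) (cong (count P? (g zero) +_) (count-concat P? (g ∘ suc))))

length-concat : ∀ {n} (g : Fin n → List A) → length (concat (tabulate g)) ≡ ∑ (length ∘ g)
length-concat {n = zero}  g = refl
length-concat {n = suc n} g = trans (length-++ (g zero)) (cong (length (g zero) +_) (length-concat (g ∘ suc)))

count-complement : {P : A → Set} (P? : Decidable P) → ∀ xs → count (¬? ∘ P?) xs + count P? xs ≡ length xs
count-complement P? []       = refl
count-complement P? (x ∷ xs) with P? x
... | yes _ = trans (+-suc _ _) (cong suc (count-complement P? xs))
... | no  _ = cong suc (count-complement P? xs)

module _ {n : ℕ} (G : Fin n → FinGraph) where
  private module G i = FinGraph (G i)

  order-∇ : FinGraph.order (∇ G) ≡ ∑ G.order
  order-∇ = trans (length-concat (blocks G)) (∑-cong λ i → length-map {B = Σ (Fin n) G.V} (i ,_) (G.vertices i))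
    where
    ∑-cong : ∀ {m} {g h : Fin m → ℕ} → (∀ i → g i ≡ h i) → ∑ g ≡ ∑ h
    ∑-cong {zero}  eq = refl
    ∑-cong {suc m} eq = cong₂ _+_ (eq zero) (∑-cong (eq ∘ suc))

  count-block : ∀ i → count (λ w → proj₁ w ≟ᶠ i) (FinGraph.vertices (∇ G)) ≡ G.order i
  count-block i = begin
    count in-i? (concat (tabulate (blocks G)))  ≡⟨ count-concat in-i? (blocks G) ⟩
    ∑ (count in-i? ∘ blocks G)                  ≡⟨ ∑-point (count in-i? ∘ blocks G) i other ⟩
    count in-i? (blocks G i)                    ≡⟨ cong length (filter-all in-i? (All.map⁺ (All.universal (λ _ → refl) (G.vertices i)))) ⟩
    length (blocks G i)                         ≡⟨ length-map {B = Σ (Fin n) G.V} (i ,_) (G.vertices i) ⟩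
    G.order i                                   ∎
    where
    open ≡-Reasoning
    in-i? : Decidable (λ w → proj₁ w ≡ i)
    in-i? w = proj₁ w ≟ᶠ i
    other : ∀ j → j ≢ i → count in-i? (blocks G j) ≡ 0
    other j j≢i = cong length (filter-none in-i? (All.map⁺ (All.universal (λ _ → j≢i) (G.vertices j))))

  count-outside : ∀ i → count (λ w → ¬? (proj₁ w ≟ᶠ i)) (FinGraph.vertices (∇ G)) ≡ ∑ G.order ∸ G.order i
  count-outside i = begin
    out                              ≡⟨ sym (m+n∸n≡m out (G.order i)) ⟩
    out + G.order i ∸ G.order i      ≡⟨ cong (λ k → out + k ∸ G.order i) (sym (count-block i)) ⟩
    out + count (λ w → proj₁ w ≟ᶠ i) (FinGraph.vertices (∇ G)) ∸ G.order i
      ≡⟨ cong (_∸ G.order i) (trans (count-complement (λ w → proj₁ w ≟ᶠ i) (FinGraph.vertices (∇ G))) order-∇) ⟩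
    ∑ G.order ∸ G.order i            ∎
    where
    open ≡-Reasoning
    out = count (λ w → ¬? (proj₁ w ≟ᶠ i)) (FinGraph.vertices (∇ G))

-- Passage to rational numbers and the final inequality.

∏-cong : ∀ {m} {g h : Fin m → ℕ} → (∀ i → g i ≡ h i) → ∏ g ≡ ∏ h
∏-cong {zero}  eq = refl
∏-cong {suc m} eq = cong₂ _*ⁿ_ (eq zero) (∏-cong (eq ∘ suc))

open import Data.Integer.Base using (+_)

-- For unnormalised fractions the order is comparison of cross products, so the inequality of
-- naturals transfers without cancelling common factors.
*≤*⇒/≤/ : ∀ a c d m .{{_ : NonZero m}} → a *ⁿ m ≤ⁿ c *ⁿ d → (+ a) / 1 ≤ ((+ c) / 1) * ((+ d) / m)
*≤*⇒/≤/ a c d m@(suc m-1) am≤cd = toℚᵘ-cancel-≤ (begin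
  toℚᵘ ((+ a) / 1)                          ≃⟨ toℚᵘ-fromℚᵘ (ℚᵘ.mkℚᵘ (+ a) 0) ⟩
  ℚᵘ.mkℚᵘ (+ a) 0                           ≤⟨ ℚᵘ.*≤* le ⟩
  ℚᵘ.mkℚᵘ (+ c) 0 ℚᵘ.* ℚᵘ.mkℚᵘ (+ d) m-1    ≃⟨ ℚᵘ.*-cong (toℚᵘ-fromℚᵘ (ℚᵘ.mkℚᵘ (+ c) 0)) (toℚᵘ-fromℚᵘ (ℚᵘ.mkℚᵘ (+ d) m-1)) ⟨
  toℚᵘ ((+ c) / 1) ℚᵘ.* toℚᵘ ((+ d) / m)    ≃⟨ toℚᵘ-homo-* ((+ c) / 1) ((+ d) / m) ⟨
  toℚᵘ (((+ c) / 1) * ((+ d) / m))         ∎)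
  where
  open ℚᵘ.≤-Reasoning
  le : (+ a) ℤ.* (+ (1 *ⁿ m)) ℤ.≤ ((+ c) ℤ.* (+ d)) ℤ.* (+ 1)
  -- The product `1 *ⁿ m` of the denominators computes to `suc (m-1 + 0)`, which accounts for the
  -- first rewrite.
  le rewrite +-identityʳ m-1 | ℤ.*-identityʳ ((+ c) ℤ.* (+ d)) | sym (ℤ.pos-* a (suc m-1)) | sym (ℤ.pos-* c d) = ℤ.+≤+ am≤cd

theorem5p1 : (n : ℕ) (n≥2 : 2 ≤ⁿ n)
    (G : Fin n → FinGraph) (vᵢ≥1 : ∀ i → 1 ≤ⁿ FinGraph.order (G i)) →
    let vᵢ = λ i → FinGraph.order (G i)
        v = ∑ vᵢ
        instance nonZero = ∏[v∸vᵢ]≢0 n≥2 vᵢ vᵢ≥1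
    in (+ τ (∇ G)) / 1 ≤ ((+ (v ^ (n ∸ 2))) / 1) * ((+ ∏-degrees (∇ G)) / ∏ (λ i → v ∸ vᵢ i))
theorem5p1 n n≥2 G vᵢ≥1 =
  *≤*⇒/≤/ (τ (∇ G)) (v ^ (n ∸ 2)) (∏-degrees (∇ G)) (∏ (λ i → v ∸ vᵢ i)) {{∏[v∸vᵢ]≢0 n≥2 vᵢ vᵢ≥1}} (begin
    τ (∇ G) *ⁿ ∏ (λ i → v ∸ vᵢ i)           ≡⟨ cong (τ (∇ G) *ⁿ_) (∏-cong (sym ∘ count-outside G)) ⟩
    τ (∇ G) *ⁿ ∏ (length ∘ J.outside)       ≤⟨ J.τ-bound ⟩
    FinGraph.order (∇ G) ^ (n ∸ 2) *ⁿ ∏-degrees (∇ G)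
      ≡⟨ cong (λ k → k ^ (n ∸ 2) *ⁿ ∏-degrees (∇ G)) (order-∇ G) ⟩
    v ^ (n ∸ 2) *ⁿ ∏-degrees (∇ G)          ∎)
  where
  open ≤-Reasoning
  vᵢ : Fin n → ℕ
  vᵢ i = FinGraph.order (G i)
  v : ℕ
  v = ∑ vᵢ
  inhabited : ∀ i → ∃[ u ] proj₁ {B = FinGraph.V ∘ G} u ≡ i
  inhabited i with FinGraph.vertices (G i) | vᵢ≥1 i
  ... | x ∷ _ | _ = (i , x) , refl
  module J = BlockGraph (∇ G) n≥2 proj₁ inhabited across
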